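{- Let $\Gamma$ be a finite set of PDL formulas. If $\Gamma$ is consistent, i.e. there is no closed PDL-tableau for $\Gamma$, then $\Gamma$ is satisfiable.
   Context: PDL syntax: $\phi ::= \bot \mid p \mid \lnot\phi \mid \phi\land\phi \mid [\alpha]\phi$, $\alpha ::= a \mid \tau? \mid \alpha\cup\beta \mid \alpha;\beta \mid \alpha^\ast$ ($a$ atomic programs), with standard Kripke semantics. For a list $\bar\delta=\delta_1\cdots\delta_n$ of programs, $\Box(\bar\delta,\phi)=[\delta_1]\cdots[\delta_n]\phi$ ($=\phi$ if $\bar\delta=\varepsilon$); juxtaposition is concatenation. Unfolding boxes: $\mathit{Tests}(a)=\emptyset$, $\mathit{Tests}(\tau?)=\{\tau\}$, $\mathit{Tests}(\alpha\cup\beta)=\mathit{Tests}(\alpha;\beta)=\mathit{Tests}(\alpha)\cup\mathit{Tests}(\beta)$, $\mathit{Tests}(\alpha^\ast)=\mathit{Tests}(\alpha)$. For a set $\ell$ of formulas: $P^\ell(a)=\{a\}$; $P^\ell(\tau?)=\{\varepsilon\}$ if $\tau\in\ell$, else $\emptyset$; $P^\ell(\beta\cup\gamma)=P^\ell(\beta)\cup P^\ell(\gamma)$; $P^\ell(\beta;\gamma)=\{\bar\beta\gamma\mid\bar\beta\in P^\ell(\beta)\setminus\{\varepsilon\}\}\cup\{\bar\gamma\mid\bar\gamma\in P^\ell(\gamma),\varepsilon\in P^\ell(\beta)\}$; $P^\ell(\beta^\ast)=\{\varepsilon\}\cup\{\bar\beta\beta^\ast\mid\bar\beta\in P^\ell(\beta)\setminus\{\varepsilon\}\}$.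 $F^\ell(\alpha)=\{\lnot\tau\mid\tau\in\mathit{Tests}(\alpha),\tau\notin\ell\}$, $X^\ell_{\alpha,\psi}=F^\ell(\alpha)\cup\{\Box(\bar\alpha,\psi)\mid\bar\alpha\in P^\ell(\alpha)\}$, $\mathsf{unfold}_\Box(\alpha,\psi)=\{X^\ell_{\alpha,\psi}\mid\ell\subseteq\mathit{Tests}(\alpha)\}$. Unfolding diamonds: $H_a=\{(\emptyset,a)\}$, $H_{\tau?}=\{(\{\tau\},\varepsilon)\}$, $H_{\alpha\cup\beta}=H_\alpha\cup H_\beta$, $H_{\alpha;\beta}=\{(X,\bar\delta\beta)\mid(X,\bar\delta)\in H_\alpha,\bar\delta\neq\varepsilon\}\cup\{(X\cup Y,\bar\delta)\mid(X,\varepsilon)\in H_\alpha,(Y,\bar\delta)\in H_\beta\}$, $H_{\alpha^\ast}=\{(\emptyset,\varepsilon)\}\cup\{(X,\bar\delta\alpha^\ast)\mid(X,\bar\delta)\in H_\alpha,\bar\delta\neq\varepsilon\}$; $\mathsf{unfold}_\Diamond(\alpha,\psi)=\{X\cup\{\lnot\Box(\bar\delta,\psi)\}\mid(X,\bar\delta)\in H_\alpha\}$. Loading: each program $\alpha$ has a marked copy $\underline\alpha$ (semantically identical). A loaded formula has the form $\lnot[\underline{\alpha_1}]\cdots[\underline{\alpha_n}]\phi$, $n\ge1$, $\phi$ an unmarked PDL formula; $\xi$ ranges over PDL formulas and expressions $[\underline{\alpha_1}]\cdots[\underline{\alpha_k}]\phi$, $k\ge1$. $\underline\Box(\bar\delta,\xi)=[\underline{\delta_1}]\cdots[\underline{\delta_n}]\xi$,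 $\underline{\mathsf{unfold}}_\Diamond(\alpha,\xi)=\{X\cup\{\lnot\underline\Box(\bar\delta,\xi)\}\mid(X,\bar\delta)\in H_\alpha\}$. A sequent (finite set of possibly loaded formulas) is loaded if it contains a loaded formula, else free; it is basic if all its formulas have the form $\bot,\lnot\bot,p,\lnot p,[a]\phi,\lnot[a]\phi$ ($a$ atomic). $\Delta_a=\{\phi\mid[a]\phi\in\Delta\}$. Rules (principal formula not in context $\Delta$): $(\lnot)$ $\Delta,\lnot\lnot\phi/\Delta,\phi$; $(\land)$ $\Delta,\phi\land\psi/\Delta,\phi,\psi$; $(\lnot\land)$ $\Delta,\lnot(\phi\land\psi)/\Delta,\lnot\phi\mid\Delta,\lnot\psi$; $(\Box)$ $\Delta,[\alpha]\phi/\{\Delta\cup\Gamma\mid\Gamma\in\mathsf{unfold}_\Box(\alpha,\phi)\}$, $\alpha$ non-atomic; $(\Diamond)$ $\Delta,\lnot[\alpha]\phi/\{\Delta\cup\Gamma\mid\Gamma\in\mathsf{unfold}_\Diamond(\alpha,\phi)\}$, $\alpha$ non-atomic; $(\underline\Diamond)$ $\Delta,\lnot[\underline\alpha]\xi/\{\Delta\cup\Gamma\mid\Gamma\in\underline{\mathsf{unfold}}_\Diamond(\alpha,\xi)\}$, $\alpha$ non-atomic; $(L+)$ $\Delta,\lnot[a][\alpha_1]\cdots[\alpha_n]\phi/\Delta,\lnot[\underline a][\underline{\alpha_1}]\cdots[\underline{\alpha_n}]\phi$ with $\Delta$ free and basic, $n\ge0$ maximal; $(L-)$ $\Delta,\lnot[\underline{\alpha_1}]\cdots[\underline{\alpha_n}]\phi/\Delta,\lnot[\alpha_1]\cdots[\alpha_n]\phi$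 with $\Delta$ basic, $n\ge1$; modal rule $(M)$ $\Delta,\lnot[\underline a]\xi/\Delta_a,\lnot\xi$ with $\Delta$ basic. $(L-)$ may not be applied to a node produced by $(L+)$. A tableau is a rooted tree labelled by sequents in which each interior node with its children is a rule instance. A repeat is a node whose label equals that of a proper ancestor (nearest such: its companion); it is a loaded-path repeat if all nodes from companion to it are loaded, a free repeat if it is free. A PDL-tableau is a tableau in which all loaded-path repeats and all free repeats are leaves. A node is closed if its label contains $\bot$ or some $\phi$ and $\lnot\phi$; a PDL-tableau is closed if every leaf is closed or a loaded-path repeat. -}

module Defs where

open import Level using (Level)
open import Data.Nat using (ℕ)
open import Data.Bool using (Bool; true; false; if_then_else_)
open import Data.Unit using (⊤)
open import Data.Empty using (⊥)
open import Data.Product using (Σ; ∃; ∃-syntax; _×_; _,_)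
open import Data.Sum using (_⊎_)
open import Data.List using (List; []; _∷_; _++_; [_]; map)
open import Data.List.Relation.Unary.All using (All)
open import Data.List.Relation.Unary.Any using (Any)
open import Data.List.Membership.Propositional using (_∈_; _∉_)
open import Data.List.Relation.Binary.Subset.Propositional using (_⊆_)
open import Relation.Binary.PropositionalEquality using (_≡_; _≢_)
open import Relation.Binary.Construct.Closure.ReflexiveTransitive using (Star)
open import Relation.Nullary using (¬_)

infixr 6 ~_
infixr 5 _⋀_
infixr 6 ⟦_⟧_

mutual
  data Form : Set where
    bot  : Form
    var  : ℕ → Form
    ~_   : Form → Form
    _⋀_  : Form → Form → Form
    ⟦_⟧_ : Prog → Form → Form

  data Prog : Set where
    atm  : ℕ → Prog
    _¿   : Form → Prog
    _∪ₚ_ : Prog → Prog → Prog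
    _⨟_  : Prog → Prog → Prog
    _✶   : Prog → Prog

boxes : List Prog → Form → Form
boxes []       φ = φ
boxes (δ ∷ δs) φ = ⟦ δ ⟧ boxes δs φ

record Model : Set₁ where
  field
    W : Set
    R : ℕ → W → W → Set
    V : ℕ → W → Set

module Sem (M : Model) where
  open Model M
  mutual
    _⊨_ : W → Form → Set
    w ⊨ bot       = ⊥
    w ⊨ var p     = V p w
    w ⊨ (~ φ)     = ¬ (w ⊨ φ)
    w ⊨ (φ ⋀ ψ)   = (w ⊨ φ) × (w ⊨ ψ)
    w ⊨ (⟦ α ⟧ φ) = ∀ v → Rel α w v → v ⊨ φ

    Rel : Prog → W → W → Set
    Rel (atm a)   w v = R a w v
    Rel (τ ¿)     w v = (w ≡ v) × (w ⊨ τ)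
    Rel (α ∪ₚ β)  w v = Rel α w v ⊎ Rel β w v
    Rel (α ⨟ β)   w v = ∃[ u ] (Rel α w u × Rel β u v)
    Rel (α ✶)     w v = Star (Rel α) w v

Satisfiable : List Form → Set₁
Satisfiable Γ = Σ Model λ M → Σ (Model.W M) λ w → All (λ φ → Sem._⊨_ M w φ) Γ

Tests : Prog → List Form
Tests (atm a)  = []
Tests (τ ¿)    = [ τ ]
Tests (α ∪ₚ β) = Tests α ++ Tests β
Tests (α ⨟ β)  = Tests α ++ Tests β
Tests (α ✶)    = Tests α

data P (ℓ : List Form) : Prog → List Prog → Set where
  pAtm   : ∀ {a} → P ℓ (atm a) [ atm a ]
  pTest  : ∀ {τ} → τ ∈ ℓ → P ℓ (τ ¿) []
  pUnL   : ∀ {β γ ds} → P ℓ β ds → P ℓ (β ∪ₚ γ) ds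
  pUnR   : ∀ {β γ ds} → P ℓ γ ds → P ℓ (β ∪ₚ γ) ds
  pSeqN  : ∀ {β γ d ds} → P ℓ β (d ∷ ds) → P ℓ (β ⨟ γ) ((d ∷ ds) ++ [ γ ])
  pSeqE  : ∀ {β γ ds} → P ℓ β [] → P ℓ γ ds → P ℓ (β ⨟ γ) ds
  pStarE : ∀ {β} → P ℓ (β ✶) []
  pStarN : ∀ {β d ds} → P ℓ β (d ∷ ds) → P ℓ (β ✶) ((d ∷ ds) ++ [ β ✶ ])

data H : Prog → List Form → List Prog → Set where
  hAtm   : ∀ {a} → H (atm a) [] [ atm a ]
  hTest  : ∀ {τ} → H (τ ¿) [ τ ] []
  hUnL   : ∀ {α β X ds} → H α X ds → H (α ∪ₚ β) X ds
  hUnR   : ∀ {α β X ds} → H β X ds → H (α ∪ₚ β) X ds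
  hSeqN  : ∀ {α β X d ds} → H α X (d ∷ ds) → H (α ⨟ β) X ((d ∷ ds) ++ [ β ])
  hSeqE  : ∀ {α β X Y ds} → H α X [] → H β Y ds → H (α ⨟ β) (X ++ Y) ds
  hStarE : ∀ {α} → H (α ✶) [] []
  hStarN : ∀ {α X d ds} → H α X (d ∷ ds) → H (α ✶) X ((d ∷ ds) ++ [ α ✶ ])

-- Sequent formulas: PDL formulas and loaded formulas
-- lneg α βs φ  represents  ¬[α̲][β̲₁]⋯[β̲ₖ]φ   (n = 1 + k ≥ 1)

data SF : Set where
  plain : Form → SF
  lneg  : Prog → List Prog → Form → SF

negU : List Prog → Form → SF
negU []       φ = plain (~ φ)
negU (δ ∷ δs) φ = lneg δ δs φ

Seq : Set
Seq = List SF

-- sequents are finite sets: equality of labels is extensional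
_≈ₛ_ : Seq → Seq → Set
X ≈ₛ Y = ∀ f → (f ∈ X → f ∈ Y) × (f ∈ Y → f ∈ X)

_represents_ : Seq → (SF → Set) → Set
c represents C = ∀ f → (f ∈ c → C f) × (C f → f ∈ c)

data IsLoaded : SF → Set where
  isL : ∀ {α βs φ} → IsLoaded (lneg α βs φ)

Loaded : Seq → Set
Loaded X = Any IsLoaded X

FreeS : Seq → Set
FreeS X = ¬ Loaded X

data Basic : SF → Set where
  bBot  : Basic (plain bot)
  bNBot : Basic (plain (~ bot))
  bVar  : ∀ {p} → Basic (plain (var p))
  bNVar : ∀ {p} → Basic (plain (~ var p))
  bBox  : ∀ {a φ} → Basic (plain (⟦ atm a ⟧ φ))
  bDia  : ∀ {a φ} → Basic (plain (~ ⟦ atm a ⟧ φ))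
  bLDia : ∀ {a βs φ} → Basic (lneg (atm a) βs φ)

NonAtomic : Prog → Set
NonAtomic (atm _) = ⊥
NonAtomic _       = ⊤

NotBox : Form → Set
NotBox (⟦ _ ⟧ _) = ⊥
NotBox _         = ⊤

data RuleKind : Set where
  rNeg rAnd rNAnd rBox rDia rLDia rL+ rL- rM : RuleKind

isL+ : RuleKind → Bool
isL+ rL+ = true
isL+ _   = false

BoxIdx : Prog → Set
BoxIdx α = Σ (List Form) (λ ℓ → ℓ ⊆ Tests α)

boxConcl : (Δ : Seq) (α : Prog) (φ : Form) → BoxIdx α → SF → Set
boxConcl Δ α φ (ℓ , _) f =
  f ∈ Δ
  ⊎ ((∃[ τ ] (τ ∈ Tests α × τ ∉ ℓ × f ≡ plain (~ τ)))
     ⊎ (∃[ ᾱ ] (P ℓ α ᾱ × f ≡ plain (boxes ᾱ φ))))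

DiaIdx : Prog → Set
DiaIdx α = Σ (List Form × List Prog) (λ { (X , δs) → H α X δs })

diaConcl : (Δ : Seq) (α : Prog) (φ : Form) → DiaIdx α → SF → Set
diaConcl Δ α φ ((X , δs) , _) f =
  f ∈ Δ ⊎ (f ∈ map plain X ⊎ f ≡ plain (~ boxes δs φ))

ldiaConcl : (Δ : Seq) (α : Prog) (βs : List Prog) (φ : Form) → DiaIdx α → SF → Set
ldiaConcl Δ α βs φ ((X , δs) , _) f =
  f ∈ Δ ⊎ (f ∈ map plain X ⊎ f ≡ negU (δs ++ βs) φ)

-- Applies Δ k f I C : rule k applies with principal formula f and
-- context Δ, and its conclusions are the sets C i (i : I)
data Applies (Δ : Seq) : RuleKind → SF → (I : Set) → (I → SF → Set) → Set₁ where
  aNeg  : ∀ φ → Applies Δ rNeg (plain (~ ~ φ)) ⊤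
            (λ _ f → f ∈ Δ ⊎ f ≡ plain φ)
  aAnd  : ∀ φ ψ → Applies Δ rAnd (plain (φ ⋀ ψ)) ⊤
            (λ _ f → f ∈ Δ ⊎ (f ≡ plain φ ⊎ f ≡ plain ψ))
  aNAnd : ∀ φ ψ → Applies Δ rNAnd (plain (~ (φ ⋀ ψ))) Bool
            (λ b f → f ∈ Δ ⊎ f ≡ plain (~ (if b then φ else ψ)))
  aBox  : ∀ α φ → NonAtomic α → Applies Δ rBox (plain (⟦ α ⟧ φ)) (BoxIdx α)
            (boxConcl Δ α φ)
  aDia  : ∀ α φ → NonAtomic α → Applies Δ rDia (plain (~ ⟦ α ⟧ φ)) (DiaIdx α)
            (diaConcl Δ α φ)
  aLDia : ∀ α βs φ → NonAtomic α → Applies Δ rLDia (lneg α βs φ) (DiaIdx α)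
            (ldiaConcl Δ α βs φ)
  aL+   : ∀ a αs φ → NotBox φ → FreeS Δ → All Basic Δ →
            Applies Δ rL+ (plain (~ boxes (atm a ∷ αs) φ)) ⊤
              (λ _ f → f ∈ Δ ⊎ f ≡ lneg (atm a) αs φ)
  aL-   : ∀ α αs φ → All Basic Δ →
            Applies Δ rL- (lneg α αs φ) ⊤
              (λ _ f → f ∈ Δ ⊎ f ≡ plain (~ boxes (α ∷ αs) φ))
  aM    : ∀ a βs φ → All Basic Δ →
            Applies Δ rM (lneg (atm a) βs φ) ⊤
              (λ _ f → (∃[ ψ ] (f ≡ plain ψ × plain (⟦ atm a ⟧ ψ) ∈ Δ))
                       ⊎ f ≡ negU βs φ)

Matches : List Seq → (I : Set) → (I → SF → Set) → Set
Matches cs I C = (∀ i → Any (λ c → c represents C i) cs)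
               × All (λ c → ∃[ i ] (c represents C i)) cs

RuleInst : RuleKind → Seq → List Seq → Set₁
RuleInst k X cs =
  Σ Seq λ Δ → Σ SF λ f → (f ∉ Δ) × (X ≈ₛ (f ∷ Δ)) ×
  Σ Set λ I → Σ (I → SF → Set) λ C → Applies Δ k f I C × Matches cs I C

-- Repeats, closedness, closed PDL-tableaux
-- The history lists the labels of the proper ancestors, nearest first.

ClosedSeq : Seq → Set
ClosedSeq X = plain bot ∈ X ⊎ ∃[ φ ] (plain φ ∈ X × plain (~ φ) ∈ X)

-- X is a repeat whose companion (nearest ancestor with the same label Y)
-- is reached through loaded nodes only
LPRepeat : List Seq → Seq → Set
LPRepeat hist X =
  Σ (List Seq) λ pre → Σ Seq λ Y → Σ (List Seq) λ post →
    hist ≡ pre ++ Y ∷ post × Y ≈ₛ X × All (λ Z → ¬ (Z ≈ₛ X)) pre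
    × Loaded X × All Loaded pre × Loaded Y

FreeRepeat : List Seq → Seq → Set
FreeRepeat hist X = FreeS X × Any (λ Y → Y ≈ₛ X) hist

-- ClosedTab hist b X : a closed PDL-tableau rooted at a node labelled X,
-- whose proper ancestors are labelled hist (nearest first), where b
-- records whether this node was produced by (L+).
data ClosedTab (hist : List Seq) (b : Bool) (X : Seq) : Set₁ where
  closedLeaf : ClosedSeq X → ClosedTab hist b X
  lprLeaf    : LPRepeat hist X → ClosedTab hist b X
  step       : ¬ LPRepeat hist X → ¬ FreeRepeat hist X →
               (k : RuleKind) → (b ≡ true → k ≢ rL-) →
               (cs : List Seq) → RuleInst k X cs →
               All (ClosedTab (X ∷ hist) (isL+ k)) cs →
               ClosedTab hist b X

HasClosedTableau : List Form → Set₁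
HasClosedTableau Γ = ClosedTab [] false (map plain Γ)

Consistent : List Form → Set₁
Consistent Γ = ¬ HasClosedTableau Γ

{-# OPTIONS --safe #-}

-- Call a free sequent inconsistent if it has a closed tableau. Since a loaded path never crosses
-- a free node, the part of a closed tableau below a free node is independent of the history of
-- that node, so a free repeat in an attempted closed tableau can be cut out. Hence consistency of
-- free sequents is inherited by some child under every rule. Exhausting the local rules from a
-- consistent sequent yields a basic consistent one; the formulas met on the way form a saturated
-- set, and these sets are the worlds, with w related to v by a when ψ ∈ v for all [a]ψ ∈ w.
-- To satisfy ¬[a][α₁]⋯[αₙ]ψ, load it and alternate (M) with the local rules: all sequents consist
-- of formulas of the Fischer–Ladner closure, and a consistent loaded path has no repeats, so the
-- path ends by becoming free, which happens at a world containing ¬ψ. Each basic loaded sequent on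
-- the way is turned into a world by (L-).
--
-- Constructively, choosing a consistent child is possible only up to double negation. This is
-- harmless because satisfaction is a negative statement in the model below.
module Submission where

open import Defs
open import Data.Bool using (Bool; true; false)
open import Data.Empty using (⊥; ⊥-elim)
open import Data.List using (List; []; _∷_; _++_; [_]; map; concatMap; filter; length)
open import Data.List.Membership.Propositional using (_∈_; _∉_; lose; find)
open import Data.List.Membership.Propositional.Properties using (∈-++⁺ˡ; ∈-++⁺ʳ; ∈-++⁻; ∈-map⁺; ∈-map⁻; ∈-filter⁺; ∈-filter⁻; ∈-concatMap⁺; ∈-concatMap⁻)
open import Data.List.Properties using (++-assoc; ++-identityʳ; map-++; map-∘; filter-++; length-removeAt′) renaming (≡-dec to List-≡-dec)
open import Data.List.Relation.Binary.Pointwise using (Pointwise; []; _∷_; symmetric)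
open import Data.List.Relation.Binary.Subset.Propositional using (_⊆_)
open import Data.List.Relation.Unary.All as All using (All; []; _∷_; all?)
open import Data.List.Relation.Unary.All.Properties using () renaming (++⁺ to All-++⁺)
open import Data.List.Relation.Unary.Any using (Any; here; there; any?; index; _─_)
open import Data.List.Relation.Unary.Any.Properties using () renaming (++⁺ˡ to Any-++⁺ˡ; ++⁻ to Any-++⁻)
open import Data.Nat using (ℕ; suc; _+_; _*_; _≤_; _<_; z≤n; s≤s)
open import Data.Nat.ListAction using (sum)
open import Data.Nat.ListAction.Properties using (sum-++)
open import Data.Nat.Properties using (≤-refl; ≤-trans; ≤-reflexive; +-mono-≤; +-assoc; +-comm; m≤m+n; m≤n+m) renaming (_≟_ to _≟ℕ_)
open import Data.Product using (Σ; ∃; ∃-syntax; _×_; _,_; proj₁; proj₂)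
open import Data.Product.Properties using () renaming (≡-dec to ×-≡-dec)
open import Data.Sum using (_⊎_; inj₁; inj₂)
open import Data.Unit using (⊤; tt)
open import Function using (_∘_; id)
open import Relation.Binary.Construct.Closure.ReflexiveTransitive using (Star; ε; _◅_)
open import Relation.Binary.Definitions using (DecidableEquality)
open import Relation.Binary.PropositionalEquality using (_≡_; _≢_; refl; sym; trans; cong; cong₂; subst)
open import Relation.Nullary using (¬_; Dec; yes; no; ¬?)
open import Relation.Nullary.Decidable using (map′; _×-dec_; decidable-stable)

-- Decidable equality, transported along an embedding into binary trees.

data Tree : Set where
  leaf : ℕ → Tree
  node : ℕ → Tree → Tree → Tree

_≟ᵀ_ : DecidableEquality Tree
leaf m ≟ᵀ leaf n = map′ (cong leaf) (λ { refl → refl }) (m ≟ℕ n)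
leaf _ ≟ᵀ node _ _ _ = no λ ()
node _ _ _ ≟ᵀ leaf _ = no λ ()
node m s t ≟ᵀ node m′ s′ t′ with m ≟ℕ m′ | s ≟ᵀ s′ | t ≟ᵀ t′
... | yes refl | yes refl | yes refl = yes refl
... | no ¬p | _ | _ = no λ { refl → ¬p refl }
... | _ | no ¬p | _ = no λ { refl → ¬p refl }
... | _ | _ | no ¬p = no λ { refl → ¬p refl }

mutual
  encF : Form → Tree
  encF bot       = leaf 0
  encF (var n)   = leaf (suc n)
  encF (~ φ)     = node 0 (encF φ) (leaf 0)
  encF (φ ⋀ ψ)   = node 1 (encF φ) (encF ψ)
  encF (⟦ α ⟧ φ) = node 2 (encP α) (encF φ)

  encP : Prog → Tree
  encP (atm a)  = leaf a
  encP (τ ¿)    = node 0 (encF τ) (leaf 0)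
  encP (α ∪ₚ β) = node 1 (encP α) (encP β)
  encP (α ⨟ β)  = node 2 (encP α) (encP β)
  encP (α ✶)    = node 3 (encP α) (leaf 0)

mutual
  decF : Tree → Form
  decF (leaf 0)       = bot
  decF (leaf (suc n)) = var n
  decF (node 0 s _)   = ~ decF s
  decF (node 1 s t)   = decF s ⋀ decF t
  decF (node _ s t)   = ⟦ decP s ⟧ decF t

  decP : Tree → Prog
  decP (leaf a)     = atm a
  decP (node 0 s _) = decF s ¿
  decP (node 1 s t) = decP s ∪ₚ decP t
  decP (node 2 s t) = decP s ⨟ decP t
  decP (node _ s _) = decP s ✶

mutual
  decF-encF : ∀ φ → decF (encF φ) ≡ φ
  decF-encF bot       = refl
  decF-encF (var n)   = refl
  decF-encF (~ φ)     = cong ~_ (decF-encF φ)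
  decF-encF (φ ⋀ ψ)   = cong₂ _⋀_ (decF-encF φ) (decF-encF ψ)
  decF-encF (⟦ α ⟧ φ) = cong₂ ⟦_⟧_ (decP-encP α) (decF-encF φ)

  decP-encP : ∀ α → decP (encP α) ≡ α
  decP-encP (atm a)  = refl
  decP-encP (τ ¿)    = cong _¿ (decF-encF τ)
  decP-encP (α ∪ₚ β) = cong₂ _∪ₚ_ (decP-encP α) (decP-encP β)
  decP-encP (α ⨟ β)  = cong₂ _⨟_ (decP-encP α) (decP-encP β)
  decP-encP (α ✶)    = cong _✶ (decP-encP α)

_≟F_ : DecidableEquality Form
φ ≟F ψ = map′ (λ e → trans (sym (decF-encF φ)) (trans (cong decF e) (decF-encF ψ)))
              (cong encF) (encF φ ≟ᵀ encF ψ)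

_≟P_ : DecidableEquality Prog
α ≟P β = map′ (λ e → trans (sym (decP-encP α)) (trans (cong decP e) (decP-encP β)))
              (cong encP) (encP α ≟ᵀ encP β)

_≟S_ : DecidableEquality SF
plain φ ≟S plain ψ = map′ (cong plain) (λ { refl → refl }) (φ ≟F ψ)
plain _ ≟S lneg _ _ _ = no λ ()
lneg _ _ _ ≟S plain _ = no λ ()
lneg α βs φ ≟S lneg α′ βs′ φ′ =
  map′ (λ { refl → refl }) (λ { refl → refl })
       (×-≡-dec _≟P_ (×-≡-dec (List-≡-dec _≟P_) _≟F_) (α , βs , φ) (α′ , βs′ , φ′))

open import Data.List.Membership.DecPropositional _≟F_ using () renaming (_∈?_ to _∈F?_)
open import Data.List.Membership.DecPropositional _≟S_ using () renaming (_∈?_ to _∈S?_)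

-- Finite subsets and removal of a formula.

subs : {A : Set} → List A → List (List A)
subs []       = [ [] ]
subs (x ∷ xs) = map (x ∷_) (subs xs) ++ subs xs

module _ {A : Set} {Q : A → Set} (Q? : ∀ x → Dec (Q x)) where

  -- This makes `subs` exhaustive up to extensional equality: every decidable subset of `xs` is
  -- listed, in the form of a filter. It serves for sets of tests, for sequents over the closure and
  -- for the contents of worlds.
  filter∈subs : ∀ xs → filter Q? xs ∈ subs xs
  filter∈subs []       = here refl
  filter∈subs (x ∷ xs) with Q? x
  ... | yes _ = ∈-++⁺ˡ (∈-map⁺ (x ∷_) (filter∈subs xs))
  ... | no _  = ∈-++⁺ʳ (map (x ∷_) (subs xs)) (filter∈subs xs)

∈subs⇒⊆ : {A : Set} (xs : List A) {ys : List A} → ys ∈ subs xs → ys ⊆ xs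
∈subs⇒⊆ []       (here refl) ()
∈subs⇒⊆ (x ∷ xs) p i with ∈-++⁻ (map (x ∷_) (subs xs)) p
∈subs⇒⊆ (x ∷ xs) p i | inj₁ q with ∈-map⁻ (x ∷_) q
∈subs⇒⊆ (x ∷ xs) p (here e)  | inj₁ q | _ , _ , refl = here e
∈subs⇒⊆ (x ∷ xs) p (there i) | inj₁ q | _ , r , refl = there (∈subs⇒⊆ xs r i)
∈subs⇒⊆ (x ∷ xs) p i | inj₂ q = there (∈subs⇒⊆ xs q i)

infixl 5 _∖_

_∖_ : Seq → SF → Seq
X ∖ f = filter (λ g → ¬? (g ≟S f)) X

∈-∖⁺ : ∀ {X f g} → g ∈ X → g ≢ f → g ∈ X ∖ f
∈-∖⁺ {f = f} i ne = ∈-filter⁺ (λ g → ¬? (g ≟S f)) i ne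

∈-∖⁻ : ∀ X {f g} → g ∈ X ∖ f → g ∈ X × g ≢ f
∈-∖⁻ X {f} i = ∈-filter⁻ (λ g → ¬? (g ≟S f)) {xs = X} i

∉-∖ : ∀ X f → f ∉ X ∖ f
∉-∖ X f i = proj₂ (∈-∖⁻ X i) refl

∖-≈ : ∀ {X f} → f ∈ X → X ≈ₛ (f ∷ (X ∖ f))
∖-≈ {X} {f} f∈X g = to , from
  where
  to : g ∈ X → g ∈ f ∷ (X ∖ f)
  to i with g ≟S f
  ... | yes refl = here refl
  ... | no ne    = there (∈-∖⁺ i ne)
  from : g ∈ f ∷ (X ∖ f) → g ∈ X
  from (here refl) = f∈X
  from (there i)   = proj₁ (∈-∖⁻ X i)

-- Unfoldings and weights.

seqH : Prog → List (List Form × List Prog) → List Form × List Prog → List (List Form × List Prog)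
seqH β hs (X , [])     = map (λ { (Y , ds) → X ++ Y , ds }) hs
seqH β hs (X , d ∷ ds) = [ (X , (d ∷ ds) ++ [ β ]) ]

starH : Prog → List Form × List Prog → List (List Form × List Prog)
starH α (X , [])     = []
starH α (X , d ∷ ds) = [ (X , (d ∷ ds) ++ [ α ✶ ]) ]

enumH : Prog → List (List Form × List Prog)
enumH (atm a)  = [ ([] , [ atm a ]) ]
enumH (τ ¿)    = [ ([ τ ] , []) ]
enumH (α ∪ₚ β) = enumH α ++ enumH β
enumH (α ⨟ β)  = concatMap (seqH β (enumH β)) (enumH α)
enumH (α ✶)    = ([] , []) ∷ concatMap (starH α) (enumH α)

∈-concatMap : {A B : Set} (f : A → List B) {xs : List A} {x : A} {y : B} → x ∈ xs → y ∈ f x → y ∈ concatMap f xs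
∈-concatMap f i j = ∈-concatMap⁺ f (lose i j)

enumH-complete : ∀ {α X ds} → H α X ds → (X , ds) ∈ enumH α
enumH-complete hAtm      = here refl
enumH-complete hTest     = here refl
enumH-complete (hUnL h)  = ∈-++⁺ˡ (enumH-complete h)
enumH-complete {α = α ∪ₚ _} (hUnR h) = ∈-++⁺ʳ (enumH α) (enumH-complete h)
enumH-complete {α = _ ⨟ β} (hSeqN h) = ∈-concatMap (seqH β (enumH β)) (enumH-complete h) (here refl)
enumH-complete {α = _ ⨟ β} (hSeqE {X = X} h k) =
  ∈-concatMap (seqH β (enumH β)) (enumH-complete h)
    (∈-map⁺ (λ { (Y , ds) → X ++ Y , ds }) (enumH-complete k))
enumH-complete hStarE    = here refl
enumH-complete {α = α ✶} (hStarN h) = there (∈-concatMap (starH α) (enumH-complete h) (here refl))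

enumH-sound : ∀ α {X ds} → (X , ds) ∈ enumH α → H α X ds
enumH-sound (atm a) (here refl) = hAtm
enumH-sound (τ ¿) (here refl) = hTest
enumH-sound (α ∪ₚ β) i with ∈-++⁻ (enumH α) i
... | inj₁ j = hUnL (enumH-sound α j)
... | inj₂ j = hUnR (enumH-sound β j)
enumH-sound (α ⨟ β) i with find (∈-concatMap⁻ (seqH β (enumH β)) {xs = enumH α} i)
... | (X , d ∷ ds) , j , here refl = hSeqN (enumH-sound α j)
... | (X , []) , j , k with ∈-map⁻ (λ { (Y , ds) → X ++ Y , ds }) k
...   | _ , l , refl = hSeqE (enumH-sound α j) (enumH-sound β l)
enumH-sound (α ✶) (here refl) = hStarE
enumH-sound (α ✶) (there i) with find (∈-concatMap⁻ (starH α) {xs = enumH α} i)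
... | (X , d ∷ ds) , j , here refl = hStarN (enumH-sound α j)

-- Together with `P⇒H` this ties the two unfoldings together: `P ℓ α` consists of the lists that `H`
-- offers with all their tests in `ℓ`. Thus `enumH` serves to enumerate both.
H⇒P : ∀ {ℓ α X ds} → H α X ds → X ⊆ ℓ → P ℓ α ds
H⇒P hAtm s            = pAtm
H⇒P hTest s           = pTest (s (here refl))
H⇒P (hUnL h) s        = pUnL (H⇒P h s)
H⇒P (hUnR h) s        = pUnR (H⇒P h s)
H⇒P (hSeqN h) s       = pSeqN (H⇒P h s)
H⇒P (hSeqE {X = X} h k) s = pSeqE (H⇒P h (s ∘ ∈-++⁺ˡ)) (H⇒P k (s ∘ ∈-++⁺ʳ X))
H⇒P hStarE s          = pStarE
H⇒P (hStarN h) s      = pStarN (H⇒P h s)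

P⇒H : ∀ {ℓ α ds} → P ℓ α ds → ∃[ X ] (H α X ds × All (_∈ ℓ) X)
P⇒H pAtm      = [] , hAtm , []
P⇒H (pTest i) = _ , hTest , i ∷ []
P⇒H (pUnL p)  with P⇒H p
... | X , h , s = X , hUnL h , s
P⇒H (pUnR p)  with P⇒H p
... | X , h , s = X , hUnR h , s
P⇒H (pSeqN p) with P⇒H p
... | X , h , s = X , hSeqN h , s
P⇒H (pSeqE p q) with P⇒H p | P⇒H q
... | X , h , s | Y , k , t = X ++ Y , hSeqE h k , All-++⁺ s t
P⇒H pStarE    = [] , hStarE , []
P⇒H (pStarN p) with P⇒H p
... | X , h , s = X , hStarN h , s

H-tests : ∀ {α X ds} → H α X ds → X ⊆ Tests α
H-tests hTest i = i
H-tests (hUnL h) i = ∈-++⁺ˡ (H-tests h i)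
H-tests {α ∪ₚ β} (hUnR h) i = ∈-++⁺ʳ (Tests α) (H-tests h i)
H-tests (hSeqN h) i = ∈-++⁺ˡ (H-tests h i)
H-tests {α ⨟ β} (hSeqE {X = X} h k) i with ∈-++⁻ X i
... | inj₁ j = ∈-++⁺ˡ (H-tests h j)
... | inj₂ j = ∈-++⁺ʳ (Tests α) (H-tests k j)
H-tests (hStarN h) i = H-tests h i

H-atm : ∀ {a X ds} → H (atm a) X ds → ds ≡ [ atm a ]
H-atm hAtm = refl

data AtomHead : List Prog → Set where
  empty : AtomHead []
  head  : ∀ {a ds} → AtomHead (atm a ∷ ds)

-- The formula `boxes ds φ` is therefore `φ` itself or a box with an atomic program, which weighs 0.
-- This is why even the unfolding of `α ✶` lowers the weight.
H-head : ∀ {α X ds} → H α X ds → AtomHead ds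
H-head hAtm     = head
H-head hTest    = empty
H-head (hUnL h) = H-head h
H-head (hUnR h) = H-head h
H-head (hSeqN h) with H-head h
... | head = head
H-head (hSeqE h k) = H-head k
H-head hStarE   = empty
H-head (hStarN h) with H-head h
... | head = head

boxes-++ : ∀ ds es φ → boxes (ds ++ es) φ ≡ boxes ds (boxes es φ)
boxes-++ []       es φ = refl
boxes-++ (d ∷ ds) es φ = cong (⟦ d ⟧_) (boxes-++ ds es φ)

unload : SF → Form
unload (plain φ)     = φ
unload (lneg α βs φ) = ~ boxes (α ∷ βs) φ

unload-negU : ∀ δs φ → unload (negU δs φ) ≡ ~ boxes δs φ
unload-negU []       φ = refl
unload-negU (δ ∷ δs) φ = refl

_⊆F?_ : ∀ X ℓ → Dec (All (_∈ ℓ) X)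
X ⊆F? ℓ = all? (_∈F? ℓ) X

listP : List Form → Prog → List (List Prog)
listP ℓ α = map proj₂ (filter (λ h → proj₁ h ⊆F? ℓ) (enumH α))

boxExp : Prog → Form → List Form → List Form
boxExp α φ ℓ = map ~_ (filter (λ τ → ¬? (τ ∈F? ℓ)) (Tests α)) ++ map (λ ds → boxes ds φ) (listP ℓ α)

-- The box and diamond clauses also cover atomic programs, where they return the formula unchanged;
-- rule applications are kept off this case by `wt⁺ φ ≢ 0`.
expF : Form → List (List Form)
expF (~ ~ φ)       = [ [ φ ] ]
expF (φ ⋀ ψ)       = [ φ ∷ ψ ∷ [] ]
expF (~ (φ ⋀ ψ))   = [ ~ φ ] ∷ [ ~ ψ ] ∷ []
expF (⟦ α ⟧ φ)     = map (boxExp α φ) (subs (Tests α))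
expF (~ (⟦ α ⟧ φ)) = map (λ h → proj₁ h ++ [ ~ boxes (proj₂ h) φ ]) (enumH α)
expF _             = []

exp : SF → List (List SF)
exp (plain φ)     = map (map plain) (expF φ)
exp (lneg α βs φ) = map (λ h → map plain (proj₁ h) ++ [ negU (proj₂ h ++ βs) φ ]) (enumH α)

unload-plain : ∀ X → map unload (map plain X) ≡ X
unload-plain []      = refl
unload-plain (x ∷ X) = cong (x ∷_) (unload-plain X)

exp-unload : ∀ f {e} → e ∈ exp f → map unload e ∈ expF (unload f)
exp-unload (plain φ) i with ∈-map⁻ (map plain) i
... | e , j , refl rewrite unload-plain e = j
exp-unload (lneg α βs φ) i with ∈-map⁻ _ i
... | (X , ds) , j , refl
  rewrite map-++ unload (map plain X) [ negU (ds ++ βs) φ ] | unload-plain X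
        | unload-negU (ds ++ βs) φ | boxes-++ ds βs φ
  = ∈-map⁺ (λ h → proj₁ h ++ [ ~ boxes (proj₂ h) (boxes βs φ) ]) j

∈listP⁺ : ∀ {ℓ α ds} → P ℓ α ds → ds ∈ listP ℓ α
∈listP⁺ {ℓ} p with P⇒H p
... | X , h , s = ∈-map⁺ proj₂ (∈-filter⁺ (λ h → proj₁ h ⊆F? ℓ) (enumH-complete h) s)

∈listP⁻ : ∀ {ℓ} α {ds} → ds ∈ listP ℓ α → P ℓ α ds
∈listP⁻ {ℓ} α i with ∈-map⁻ proj₂ i
... | (X , ds) , j , refl with ∈-filter⁻ (λ h → proj₁ h ⊆F? ℓ) {xs = enumH α} j
...   | k , s = H⇒P (enumH-sound α k) (All.lookup s)

wtBox : Prog → ℕ → ℕ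
wtBox (atm _) _ = 0
wtBox _       n = suc n

wtBox-suc : ∀ α {n} → NonAtomic α → wtBox α n ≡ suc n
wtBox-suc (_ ¿)    _ = refl
wtBox-suc (_ ∪ₚ _) _ = refl
wtBox-suc (_ ⨟ _)  _ = refl
wtBox-suc (_ ✶)    _ = refl

wtBox≢0 : ∀ α {n} → wtBox α n ≢ 0 → NonAtomic α
wtBox≢0 (atm _)  ne = ne refl
wtBox≢0 (_ ¿)    _ = tt
wtBox≢0 (_ ∪ₚ _) _ = tt
wtBox≢0 (_ ⨟ _)  _ = tt
wtBox≢0 (_ ✶)    _ = tt

-- wt⁺ φ and wt⁻ φ are weights of φ and ¬φ; they vanish exactly on basic formulas. The factor
-- length (enumH α) accounts for the copies of φ in boxExp α φ ℓ, a list that may contain duplicates.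
mutual
  wt⁺ : Form → ℕ
  wt⁺ bot       = 0
  wt⁺ (var _)   = 0
  wt⁺ (~ φ)     = wt⁻ φ
  wt⁺ (φ ⋀ ψ)   = suc (wt⁺ φ + wt⁺ ψ)
  wt⁺ (⟦ α ⟧ φ) = wtBox α (wtT⁻ α + length (enumH α) * wt⁺ φ)

  wt⁻ : Form → ℕ
  wt⁻ bot       = 0
  wt⁻ (var _)   = 0
  wt⁻ (~ φ)     = suc (wt⁺ φ)
  wt⁻ (φ ⋀ ψ)   = suc (wt⁻ φ + wt⁻ ψ)
  wt⁻ (⟦ α ⟧ φ) = wtBox α (wtT⁺ α + wt⁻ φ)

  wtT⁺ : Prog → ℕ
  wtT⁺ (atm _)  = 0
  wtT⁺ (τ ¿)    = wt⁺ τ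
  wtT⁺ (α ∪ₚ β) = wtT⁺ α + wtT⁺ β
  wtT⁺ (α ⨟ β)  = wtT⁺ α + wtT⁺ β
  wtT⁺ (α ✶)    = wtT⁺ α

  wtT⁻ : Prog → ℕ
  wtT⁻ (atm _)  = 0
  wtT⁻ (τ ¿)    = wt⁻ τ
  wtT⁻ (α ∪ₚ β) = wtT⁻ α + wtT⁻ β
  wtT⁻ (α ⨟ β)  = wtT⁻ α + wtT⁻ β
  wtT⁻ (α ✶)    = wtT⁻ α

weight : Seq → ℕ
weight X = sum (map (wt⁺ ∘ unload) X)

Σwt : List Form → ℕ
Σwt X = sum (map wt⁺ X)

Σwt-++ : ∀ X Y → Σwt (X ++ Y) ≡ Σwt X + Σwt Y
Σwt-++ X Y = trans (cong sum (map-++ wt⁺ X Y)) (sum-++ (map wt⁺ X) (map wt⁺ Y))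

H-wt : ∀ {α X ds} → H α X ds → Σwt X ≤ wtT⁺ α
H-wt hAtm = z≤n
H-wt {τ ¿} hTest = ≤-reflexive (+-comm (wt⁺ τ) 0)
H-wt (hUnL h) = ≤-trans (H-wt h) (m≤m+n _ _)
H-wt {α ∪ₚ β} (hUnR h) = ≤-trans (H-wt h) (m≤n+m _ (wtT⁺ α))
H-wt (hSeqN h) = ≤-trans (H-wt h) (m≤m+n _ _)
H-wt (hSeqE {X = X} {Y} h k) = ≤-trans (≤-reflexive (Σwt-++ X Y)) (+-mono-≤ (H-wt h) (H-wt k))
H-wt hStarE = z≤n
H-wt (hStarN h) = H-wt h

module _ {Q : Form → Set} (Q? : ∀ τ → Dec (Q τ)) where

  Σwt-failed-++ : ∀ X Y {m n} → Σwt (map ~_ (filter Q? X)) ≤ m → Σwt (map ~_ (filter Q? Y)) ≤ n →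
                  Σwt (map ~_ (filter Q? (X ++ Y))) ≤ m + n
  Σwt-failed-++ X Y p q
    rewrite filter-++ Q? X Y | map-++ ~_ (filter Q? X) (filter Q? Y)
          | Σwt-++ (map ~_ (filter Q? X)) (map ~_ (filter Q? Y)) = +-mono-≤ p q

  failed-wt : ∀ α → Σwt (map ~_ (filter Q? (Tests α))) ≤ wtT⁻ α
  failed-wt (atm a) = z≤n
  failed-wt (τ ¿) with Q? τ
  ... | yes _ = ≤-reflexive (+-comm (wt⁻ τ) 0)
  ... | no _  = z≤n
  failed-wt (α ∪ₚ β) = Σwt-failed-++ (Tests α) (Tests β) (failed-wt α) (failed-wt β)
  failed-wt (α ⨟ β)  = Σwt-failed-++ (Tests α) (Tests β) (failed-wt α) (failed-wt β)
  failed-wt (α ✶)    = failed-wt α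

boxes-wt⁺ : ∀ {ds} φ → AtomHead ds → wt⁺ (boxes ds φ) ≤ wt⁺ φ
boxes-wt⁺ φ empty = ≤-refl
boxes-wt⁺ φ head  = z≤n

boxes-wt⁻ : ∀ {ds} φ → AtomHead ds → wt⁻ (boxes ds φ) ≤ wt⁻ φ
boxes-wt⁻ φ empty = ≤-refl
boxes-wt⁻ φ head  = z≤n

unfold-wt : ∀ {Q : List Form × List Prog → Set} (Q? : ∀ h → Dec (Q h)) φ hs → (∀ {h} → h ∈ hs → AtomHead (proj₂ h)) →
  Σwt (map (λ ds → boxes ds φ) (map proj₂ (filter Q? hs))) ≤ length hs * wt⁺ φ
unfold-wt Q? φ []       at = z≤n
unfold-wt Q? φ (h ∷ hs) at with Q? h
... | yes _ = +-mono-≤ (boxes-wt⁺ φ (at (here refl))) (unfold-wt Q? φ hs (at ∘ there))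
... | no _  = ≤-trans (unfold-wt Q? φ hs (at ∘ there)) (m≤n+m _ (wt⁺ φ))

expF-wt : ∀ φ {e} → e ∈ expF φ → wt⁺ φ ≢ 0 → Σwt e < wt⁺ φ
expF-wt (~ ~ φ) (here refl) _ = s≤s (≤-reflexive (+-comm (wt⁺ φ) 0))
expF-wt (φ ⋀ ψ) (here refl) _ = s≤s (≤-reflexive (cong (wt⁺ φ +_) (+-comm (wt⁺ ψ) 0)))
expF-wt (~ (φ ⋀ ψ)) (here refl) _ = s≤s (+-mono-≤ (≤-refl {wt⁻ φ}) z≤n)
expF-wt (~ (φ ⋀ ψ)) (there (here refl)) _ = s≤s (≤-trans (≤-reflexive (+-comm (wt⁻ ψ) 0)) (m≤n+m _ (wt⁻ φ)))
expF-wt (⟦ α ⟧ φ) i ne with ∈-map⁻ (boxExp α φ) i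
... | ℓ , _ , refl rewrite wtBox-suc α {wtT⁻ α + length (enumH α) * wt⁺ φ} (wtBox≢0 α ne) =
  s≤s (≤-trans (≤-reflexive (Σwt-++ (map ~_ (filter (λ τ → ¬? (τ ∈F? ℓ)) (Tests α))) _))
        (+-mono-≤ (failed-wt (λ τ → ¬? (τ ∈F? ℓ)) α)
          (unfold-wt (λ h → proj₁ h ⊆F? ℓ) φ (enumH α) (λ j → H-head (enumH-sound α j)))))
expF-wt (~ (⟦ α ⟧ φ)) i ne with ∈-map⁻ _ i
... | (X , ds) , j , refl rewrite wtBox-suc α {wtT⁺ α + wt⁻ φ} (wtBox≢0 α ne) =
  s≤s (≤-trans (≤-reflexive (Σwt-++ X _))
        (+-mono-≤ (H-wt h) (≤-trans (≤-reflexive (+-comm (wt⁻ (boxes ds φ)) 0)) (boxes-wt⁻ φ (H-head h)))))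
  where h = enumH-sound α j

-- Only an inequality, since `X` may contain several copies of `f` and `X ∖ f` drops them all.
∖-weight : ∀ {X f} → f ∈ X → wt⁺ (unload f) + weight (X ∖ f) ≤ weight X
∖-weight {f = f} (here {xs = X} refl) with f ≟S f
... | yes _ = +-mono-≤ (≤-refl {wt⁺ (unload f)}) (∖-≤ X)
  where
  ∖-≤ : ∀ X → weight (X ∖ f) ≤ weight X
  ∖-≤ []      = z≤n
  ∖-≤ (g ∷ X) with g ≟S f
  ... | yes _ = ≤-trans (∖-≤ X) (m≤n+m _ (wt⁺ (unload g)))
  ... | no _  = +-mono-≤ (≤-refl {wt⁺ (unload g)}) (∖-≤ X)
... | no ne = ⊥-elim (ne refl)
∖-weight {g ∷ X} {f} (there i) with g ≟S f
... | yes _ = ≤-trans (∖-weight i) (m≤n+m _ (wt⁺ (unload g)))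
... | no _  = ≤-trans (≤-reflexive (trans (sym (+-assoc (wt⁺ (unload f)) (wt⁺ (unload g)) _))
                (trans (cong (_+ weight (X ∖ f)) (+-comm (wt⁺ (unload f)) (wt⁺ (unload g)))) (+-assoc (wt⁺ (unload g)) (wt⁺ (unload f)) _))))
                (+-mono-≤ (≤-refl {wt⁺ (unload g)}) (∖-weight i))

expand-weight : ∀ {X f e} → f ∈ X → wt⁺ (unload f) ≢ 0 → e ∈ exp f → weight (e ++ (X ∖ f)) < weight X
expand-weight {X} {f} {e} f∈X ne i =
  ≤-trans (s≤s (≤-reflexive (trans (cong sum (map-++ (wt⁺ ∘ unload) e (X ∖ f))) (trans (sum-++ (map (wt⁺ ∘ unload) e) _)
     (cong (λ l → sum l + weight (X ∖ f)) (map-∘ e))))))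
    (≤-trans (+-mono-≤ (expF-wt (unload f) (exp-unload f i) ne) (≤-refl {weight (X ∖ f)})) (∖-weight f∈X))

atomic? : ∀ α → (∃[ a ] α ≡ atm a) ⊎ NonAtomic α
atomic? (atm a)  = inj₁ (a , refl)
atomic? (_ ¿)    = inj₂ tt
atomic? (_ ∪ₚ _) = inj₂ tt
atomic? (_ ⨟ _)  = inj₂ tt
atomic? (_ ✶)    = inj₂ tt

nonAtomic≢0 : ∀ α {n} → NonAtomic α → wtBox α n ≢ 0
nonAtomic≢0 α na e with trans (sym (wtBox-suc α na)) e
... | ()

zero⇒Basic : ∀ f → wt⁺ (unload f) ≡ 0 → Basic f
zero⇒Basic (plain bot) _ = bBot
zero⇒Basic (plain (var _)) _ = bVar
zero⇒Basic (plain (~ bot)) _ = bNBot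
zero⇒Basic (plain (~ var _)) _ = bNVar
zero⇒Basic (plain (⟦ atm _ ⟧ _)) _ = bBox
zero⇒Basic (plain (~ ⟦ atm _ ⟧ _)) _ = bDia
zero⇒Basic (lneg (atm _) _ _) _ = bLDia

-- The Fischer–Ladner closure.

-- The program lists that remain to be executed at some point of a run of α.
res : Prog → List (List Prog)
res (atm a)  = [ atm a ] ∷ [] ∷ []
res (τ ¿)    = [ τ ¿ ] ∷ [] ∷ []
res (α ∪ₚ β) = [ α ∪ₚ β ] ∷ res α ++ res β
res (α ⨟ β)  = [ α ⨟ β ] ∷ map (_++ [ β ]) (res α) ++ res β
res (α ✶)    = [ α ✶ ] ∷ [] ∷ map (_++ [ α ✶ ]) (res α)

res-self : ∀ α → [ α ] ∈ res α
res-self (atm a)  = here refl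
res-self (τ ¿)    = here refl
res-self (α ∪ₚ β) = here refl
res-self (α ⨟ β)  = here refl
res-self (α ✶)    = here refl

res-H : ∀ {α X ds} → H α X ds → ds ∈ res α
res-H hAtm  = here refl
res-H hTest = there (here refl)
res-H (hUnL h) = there (∈-++⁺ˡ (res-H h))
res-H {α ∪ₚ β} (hUnR h) = there (∈-++⁺ʳ (res α) (res-H h))
res-H {α ⨟ β} (hSeqN h) = there (∈-++⁺ˡ (∈-map⁺ (_++ [ β ]) (res-H h)))
res-H {α ⨟ β} (hSeqE h k) = there (∈-++⁺ʳ (map (_++ [ β ]) (res α)) (res-H k))
res-H hStarE = there (here refl)
res-H {α ✶} (hStarN h) = there (there (∈-map⁺ (_++ [ α ✶ ]) (res-H h)))

res-unfold : ∀ α {δ γs X ds} → δ ∷ γs ∈ res α → H δ X ds → ds ++ γs ∈ res α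
res-unfold (atm a) (here refl) hAtm = here refl
res-unfold (atm a) (there (here ())) h
res-unfold (τ ¿) (here refl) hTest = there (here refl)
res-unfold (τ ¿) (there (here ())) h
res-unfold (α ∪ₚ β) {ds = ds} (here refl) h = subst (_∈ res (α ∪ₚ β)) (sym (++-identityʳ ds)) (res-H h)
res-unfold (α ∪ₚ β) (there i) h with ∈-++⁻ (res α) i
... | inj₁ j = there (∈-++⁺ˡ (res-unfold α j h))
... | inj₂ j = there (∈-++⁺ʳ (res α) (res-unfold β j h))
res-unfold (α ⨟ β) {ds = ds} (here refl) h = subst (_∈ res (α ⨟ β)) (sym (++-identityʳ ds)) (res-H h)
res-unfold (α ⨟ β) {ds = ds} (there i) h with ∈-++⁻ (map (_++ [ β ]) (res α)) i
... | inj₂ j = there (∈-++⁺ʳ (map (_++ [ β ]) (res α)) (res-unfold β j h))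
... | inj₁ j with ∈-map⁻ (_++ [ β ]) j
...   | [] , k , refl = there (∈-++⁺ʳ (map (_++ [ β ]) (res α)) (subst (_∈ res β) (sym (++-identityʳ ds)) (res-H h)))
...   | δ ∷ γs , k , refl = there (∈-++⁺ˡ (subst (_∈ map (_++ [ β ]) (res α)) (++-assoc ds γs [ β ])
                              (∈-map⁺ (_++ [ β ]) (res-unfold α k h))))
res-unfold (α ✶) {ds = ds} (here refl) h = subst (_∈ res (α ✶)) (sym (++-identityʳ ds)) (res-H h)
res-unfold (α ✶) {ds = ds} (there (there i)) h with ∈-map⁻ (_++ [ α ✶ ]) i
-- A finished round of `α` leaves `[ α ✶ ]`, whose unfoldings are again residuals of `α ✶`; so
-- iteration does not produce ever longer lists.
... | [] , k , refl = subst (_∈ res (α ✶)) (sym (++-identityʳ ds)) (res-H h)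
... | δ ∷ γs , k , refl = there (there (subst (_∈ map (_++ [ α ✶ ]) (res α)) (++-assoc ds γs [ α ✶ ])
                            (∈-map⁺ (_++ [ α ✶ ]) (res-unfold α k h))))

res-step : ∀ α {a γs} → atm a ∷ γs ∈ res α → γs ∈ res α
res-step (atm a) (here refl) = there (here refl)
res-step (atm a) (there (here ()))
res-step (τ ¿) (there (here ()))
res-step (α ∪ₚ β) (there i) with ∈-++⁻ (res α) i
... | inj₁ j = there (∈-++⁺ˡ (res-step α j))
... | inj₂ j = there (∈-++⁺ʳ (res α) (res-step β j))
res-step (α ⨟ β) (there i) with ∈-++⁻ (map (_++ [ β ]) (res α)) i
... | inj₂ j = there (∈-++⁺ʳ (map (_++ [ β ]) (res α)) (res-step β j))
... | inj₁ j with ∈-map⁻ (_++ [ β ]) j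
...   | [] , k , refl = there (∈-++⁺ʳ (map (_++ [ β ]) (res α)) (there (here refl)))
...   | δ ∷ γs , k , refl = there (∈-++⁺ˡ (∈-map⁺ (_++ [ β ]) (res-step α k)))
res-step (α ✶) (there (there i)) with ∈-map⁻ (_++ [ α ✶ ]) i
... | [] , k , ()
... | δ ∷ γs , k , refl = there (there (∈-map⁺ (_++ [ α ✶ ]) (res-step α k)))

res-tests : ∀ α {γs δ} → γs ∈ res α → δ ∈ γs → Tests δ ⊆ Tests α
res-tests (atm a) (here refl) (here refl) = id
res-tests (atm a) (there (here refl)) ()
res-tests (τ ¿) (here refl) (here refl) = id
res-tests (τ ¿) (there (here refl)) ()
res-tests (α ∪ₚ β) (here refl) (here refl) = id
res-tests (α ∪ₚ β) (there i) d with ∈-++⁻ (res α) i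
... | inj₁ j = ∈-++⁺ˡ ∘ res-tests α j d
... | inj₂ j = ∈-++⁺ʳ (Tests α) ∘ res-tests β j d
res-tests (α ⨟ β) (here refl) (here refl) = id
res-tests (α ⨟ β) (there i) d with ∈-++⁻ (map (_++ [ β ]) (res α)) i
... | inj₂ j = ∈-++⁺ʳ (Tests α) ∘ res-tests β j d
... | inj₁ j with ∈-map⁻ (_++ [ β ]) j
...   | γs , k , refl with ∈-++⁻ γs d
...     | inj₁ d′ = ∈-++⁺ˡ ∘ res-tests α k d′
...     | inj₂ (here refl) = ∈-++⁺ʳ (Tests α)
res-tests (α ✶) (here refl) (here refl) = id
res-tests (α ✶) (there (here refl)) ()
res-tests (α ✶) (there (there i)) d with ∈-map⁻ (_++ [ α ✶ ]) i
... | γs , k , refl with ∈-++⁻ γs d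
...   | inj₁ d′ = res-tests α k d′
...   | inj₂ (here refl) = id

-- Tests met later in an execution of `α` already belong to `Tests α`, so induction hypotheses for
-- these suffice along a whole trace.
H-res-tests : ∀ {α X ds δ} → H α X ds → δ ∈ ds → Tests δ ⊆ Tests α
H-res-tests {α} h = res-tests α (res-H h)

-- Downward closure only; the negations that the rules introduce are supplied afterwards by `±_`.
-- The field `unfold` covers boxes as well as diamonds, since the lists of `P` also arise from `H`.
record SubClosed (C : Form → Set) : Set where
  field
    neg    : ∀ {χ} → C (~ χ) → C χ
    and    : ∀ {χ θ} → C (χ ⋀ θ) → C χ × C θ
    next   : ∀ {a χ} → C (⟦ atm a ⟧ χ) → C χ
    unfold : ∀ {α χ X ds} → C (⟦ α ⟧ χ) → H α X ds → C (boxes ds χ)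
    test   : ∀ {α χ τ} → C (⟦ α ⟧ χ) → τ ∈ Tests α → C τ
open SubClosed

SubClosed-[] : SubClosed (_∈ [])
neg SubClosed-[] ()
and SubClosed-[] ()
next SubClosed-[] ()
unfold SubClosed-[] ()
test SubClosed-[] ()

SubClosed-++ : ∀ {X Y} → SubClosed (_∈ X) → SubClosed (_∈ Y) → SubClosed (_∈ X ++ Y)
SubClosed-++ {X} {Y} cX cY = record
  { neg    = λ i → by i (neg cX) (neg cY)
  ; and    = and′
  ; next   = λ i → by i (next cX) (next cY)
  ; unfold = λ i h → by i (λ j → unfold cX j h) (λ j → unfold cY j h)
  ; test   = λ i t → by i (λ j → test cX j t) (λ j → test cY j t) }
  where
  by : ∀ {φ ψ} → φ ∈ X ++ Y → (φ ∈ X → ψ ∈ X) → (φ ∈ Y → ψ ∈ Y) → ψ ∈ X ++ Y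
  by i f g with ∈-++⁻ X i
  ... | inj₁ j = ∈-++⁺ˡ (f j)
  ... | inj₂ j = ∈-++⁺ʳ X (g j)
  and′ : ∀ {χ θ} → χ ⋀ θ ∈ X ++ Y → χ ∈ X ++ Y × θ ∈ X ++ Y
  and′ i = by i (proj₁ ∘ and cX) (proj₁ ∘ and cY) , by i (proj₂ ∘ and cX) (proj₂ ∘ and cY)

mutual
  FL : Form → List Form
  FL bot       = [ bot ]
  FL (var n)   = [ var n ]
  FL (~ φ)     = ~ φ ∷ FL φ
  FL (φ ⋀ ψ)   = (φ ⋀ ψ) ∷ (FL φ ++ FL ψ)
  FL (⟦ α ⟧ φ) = map (λ γs → boxes γs φ) (res α) ++ (FL φ ++ FLP α)

  FLP : Prog → List Form
  FLP (atm a)  = []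
  FLP (τ ¿)    = FL τ
  FLP (α ∪ₚ β) = FLP α ++ FLP β
  FLP (α ⨟ β)  = FLP α ++ FLP β
  FLP (α ✶)    = FLP α

FL-self : ∀ φ → φ ∈ FL φ
FL-self bot       = here refl
FL-self (var n)   = here refl
FL-self (~ φ)     = here refl
FL-self (φ ⋀ ψ)   = here refl
FL-self (⟦ α ⟧ φ) = ∈-++⁺ˡ (∈-map⁺ (λ γs → boxes γs φ) (res-self α))

FLP-tests : ∀ α {τ} → τ ∈ Tests α → τ ∈ FLP α
FLP-tests (τ ¿) (here refl) = FL-self τ
FLP-tests (α ∪ₚ β) i with ∈-++⁻ (Tests α) i
... | inj₁ j = ∈-++⁺ˡ (FLP-tests α j)
... | inj₂ j = ∈-++⁺ʳ (FLP α) (FLP-tests β j)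
FLP-tests (α ⨟ β) i with ∈-++⁻ (Tests α) i
... | inj₁ j = ∈-++⁺ˡ (FLP-tests α j)
... | inj₂ j = ∈-++⁺ʳ (FLP α) (FLP-tests β j)
FLP-tests (α ✶) i = FLP-tests α i

mutual
  FL-closed : ∀ φ → SubClosed (_∈ FL φ)
  FL-closed bot = record { neg = λ { (here ()) } ; and = λ { (here ()) } ; next = λ { (here ()) }
                         ; unfold = λ { (here ()) } ; test = λ { (here ()) } }
  FL-closed (var n) = record { neg = λ { (here ()) } ; and = λ { (here ()) } ; next = λ { (here ()) }
                             ; unfold = λ { (here ()) } ; test = λ { (here ()) } }
  FL-closed (~ φ) = record
    { neg    = λ { (here refl) → there (FL-self φ) ; (there i) → there (neg c i) }
    ; and    = λ { (here ()) ; (there i) → there (proj₁ (and c i)) , there (proj₂ (and c i)) }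
    ; next   = λ { (here ()) ; (there i) → there (next c i) }
    ; unfold = λ { (here ()) _ ; (there i) h → there (unfold c i h) }
    ; test   = λ { (here ()) _ ; (there i) t → there (test c i t) } }
    where c = FL-closed φ
  FL-closed (φ ⋀ ψ) = record
    { neg    = λ { (here ()) ; (there i) → there (neg c i) }
    ; and    = λ { (here refl) → there (∈-++⁺ˡ (FL-self φ)) , there (∈-++⁺ʳ (FL φ) (FL-self ψ))
                 ; (there i) → there (proj₁ (and c i)) , there (proj₂ (and c i)) }
    ; next   = λ { (here ()) ; (there i) → there (next c i) }
    ; unfold = λ { (here ()) _ ; (there i) h → there (unfold c i h) }
    ; test   = λ { (here ()) _ ; (there i) t → there (test c i t) } }
    where c = SubClosed-++ (FL-closed φ) (FL-closed ψ)
  FL-closed (⟦ α ⟧ φ) = record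
    { neg = λ i → neg′ (cases i) ; and = λ i → and′ (cases i) ; next = λ i → next′ (cases i)
    ; unfold = λ i h → unfold′ (cases i) h ; test = λ i t → test′ (cases i) t }
    where
    c = SubClosed-++ (FL-closed φ) (FLP-closed α)
    Y = FL φ ++ FLP α
    -- The residual `[]` gives `φ` itself, which counts as old because it lies in `FL φ`; every
    -- other residual gives a box.
    data Cases : Form → Set where
      old : ∀ {ψ} → ψ ∈ Y → Cases ψ
      new : ∀ {δ γs} → δ ∷ γs ∈ res α → Cases (⟦ δ ⟧ boxes γs φ)
    cases : ∀ {ψ} → ψ ∈ map (λ γs → boxes γs φ) (res α) ++ Y → Cases ψ
    cases i with ∈-++⁻ (map (λ γs → boxes γs φ) (res α)) i
    ... | inj₂ j = old j
    ... | inj₁ j with ∈-map⁻ (λ γs → boxes γs φ) j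
    ...   | [] , _ , refl     = old (∈-++⁺ˡ (FL-self φ))
    ...   | δ ∷ γs , k , refl = new k
    inY : ∀ {ψ} → ψ ∈ Y → ψ ∈ map (λ γs → boxes γs φ) (res α) ++ Y
    inY = ∈-++⁺ʳ (map (λ γs → boxes γs φ) (res α))
    inR : ∀ {γs} → γs ∈ res α → boxes γs φ ∈ map (λ γs → boxes γs φ) (res α) ++ Y
    inR k = ∈-++⁺ˡ (∈-map⁺ (λ γs → boxes γs φ) k)
    neg′ : ∀ {χ} → Cases (~ χ) → _
    neg′ (old i) = inY (neg c i)
    and′ : ∀ {χ θ} → Cases (χ ⋀ θ) → _
    and′ (old i) = inY (proj₁ (and c i)) , inY (proj₂ (and c i))
    next′ : ∀ {a χ} → Cases (⟦ atm a ⟧ χ) → χ ∈ map (λ γs → boxes γs φ) (res α) ++ Y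
    next′ (old i) = inY (next c i)
    next′ (new k) = inR (res-step α k)
    unfold′ : ∀ {β χ X ds} → Cases (⟦ β ⟧ χ) → H β X ds → boxes ds χ ∈ map (λ γs → boxes γs φ) (res α) ++ Y
    unfold′ (old i) h = inY (unfold c i h)
    unfold′ {ds = ds} (new {γs = γs} k) h = subst (_∈ _) (boxes-++ ds γs φ) (inR (res-unfold α k h))
    test′ : ∀ {β χ τ} → Cases (⟦ β ⟧ χ) → τ ∈ Tests β → τ ∈ map (λ γs → boxes γs φ) (res α) ++ Y
    test′ (old i) t = inY (test c i t)
    test′ (new k) t = inY (∈-++⁺ʳ (FL φ) (FLP-tests α (res-tests α k (here refl) t)))

  FLP-closed : ∀ α → SubClosed (_∈ FLP α)
  FLP-closed (atm a)  = SubClosed-[]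
  FLP-closed (τ ¿)    = FL-closed τ
  FLP-closed (α ∪ₚ β) = SubClosed-++ (FLP-closed α) (FLP-closed β)
  FLP-closed (α ⨟ β)  = SubClosed-++ (FLP-closed α) (FLP-closed β)
  FLP-closed (α ✶)    = FLP-closed α

-- Closure under the tableau rules.

record RuleClosed (Cl : List Form) : Set where
  field
    expand : ∀ {φ e} → φ ∈ Cl → e ∈ expF φ → e ⊆ Cl
    box    : ∀ {a φ} → ⟦ atm a ⟧ φ ∈ Cl → φ ∈ Cl
    dia    : ∀ {a φ} → ~ ⟦ atm a ⟧ φ ∈ Cl → ~ φ ∈ Cl

±_ : List Form → List Form
± L = L ++ map ~_ L

module _ {L : List Form} (c : SubClosed (_∈ L)) where

  pos : ∀ {φ} → φ ∈ L → φ ∈ ± L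
  pos = ∈-++⁺ˡ

  neg± : ∀ {φ} → φ ∈ L → ~ φ ∈ ± L
  neg± i = ∈-++⁺ʳ L (∈-map⁺ ~_ i)

  unneg : ∀ {φ} → ~ φ ∈ ± L → φ ∈ L
  unneg i with ∈-++⁻ L i
  ... | inj₁ j = neg c j
  ... | inj₂ j with ∈-map⁻ ~_ j
  ...   | _ , k , refl = k

  unbox : ∀ {α φ} → ⟦ α ⟧ φ ∈ ± L → ⟦ α ⟧ φ ∈ L
  unbox i with ∈-++⁻ L i
  ... | inj₁ j = j
  ... | inj₂ j with ∈-map⁻ ~_ j
  ...   | _ , _ , ()

  unand : ∀ {φ ψ} → φ ⋀ ψ ∈ ± L → φ ⋀ ψ ∈ L
  unand i with ∈-++⁻ L i
  ... | inj₁ j = j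
  ... | inj₂ j with ∈-map⁻ ~_ j
  ...   | _ , _ , ()

  ±-closed : RuleClosed (± L)
  ±-closed = record
    { expand = λ {φ} → expand′ φ
    ; box    = λ i → pos (next c (unbox i))
    ; dia    = λ i → neg± (next c (unneg i)) }
    where
    expand′ : ∀ φ {e} → φ ∈ ± L → e ∈ expF φ → e ⊆ ± L
    expand′ (~ ~ φ) i (here refl) (here refl) = pos (neg c (unneg i))
    expand′ (φ ⋀ ψ) i (here refl) (here refl) = pos (proj₁ (and c (unand i)))
    expand′ (φ ⋀ ψ) i (here refl) (there (here refl)) = pos (proj₂ (and c (unand i)))
    expand′ (~ (φ ⋀ ψ)) i (here refl) (here refl) = neg± (proj₁ (and c (unneg i)))
    expand′ (~ (φ ⋀ ψ)) i (there (here refl)) (here refl) = neg± (proj₂ (and c (unneg i)))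
    expand′ (⟦ α ⟧ φ) i j k with ∈-map⁻ (boxExp α φ) j
    ... | ℓ , _ , refl with ∈-++⁻ (map ~_ (filter (λ τ → ¬? (τ ∈F? ℓ)) (Tests α))) k
    ...   | inj₁ l with ∈-map⁻ ~_ l
    ...     | τ , m , refl = neg± (test c (unbox i) (proj₁ (∈-filter⁻ (λ τ → ¬? (τ ∈F? ℓ)) m)))
    expand′ (⟦ α ⟧ φ) i j k | ℓ , _ , refl | inj₂ l with ∈-map⁻ (λ ds → boxes ds φ) l
    ...     | ds , m , refl = pos (unfold c (unbox i) (proj₁ (proj₂ (P⇒H (∈listP⁻ {ℓ} α m)))))
    expand′ (~ (⟦ α ⟧ φ)) i j k with ∈-map⁻ _ j
    ... | (X , ds) , l , refl with ∈-++⁻ X k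
    ...   | inj₁ m = pos (test c (unneg i) (H-tests (enumH-sound α l) m))
    ...   | inj₂ (here refl) = neg± (unfold c (unneg i) (enumH-sound α l))

closure : List Form → List Form
closure Γ = ± concatMap FL Γ

closure-closed : ∀ Γ → RuleClosed (closure Γ)
closure-closed Γ = ±-closed (closed Γ)
  where
  closed : ∀ Γ → SubClosed (_∈ concatMap FL Γ)
  closed []      = SubClosed-[]
  closed (φ ∷ Γ) = SubClosed-++ (FL-closed φ) (closed Γ)

closure-⊇ : ∀ Γ → Γ ⊆ closure Γ
closure-⊇ Γ {φ} i = ∈-++⁺ˡ (∈-concatMap FL i (FL-self φ))

-- Rule instances with explicit conclusions.

rep-++ : ∀ {D : SF → Set} {e Δ} → (∀ f → f ∈ e → D f) → (∀ f → D f → f ∈ e) →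
         (e ++ Δ) represents (λ f → f ∈ Δ ⊎ D f)
rep-++ {D} {e} {Δ} to from f = to′ , from′
  where
  to′ : f ∈ e ++ Δ → f ∈ Δ ⊎ D f
  to′ i with ∈-++⁻ e i
  ... | inj₁ j = inj₂ (to f j)
  ... | inj₂ j = inj₁ j
  from′ : f ∈ Δ ⊎ D f → f ∈ e ++ Δ
  from′ (inj₁ i) = ∈-++⁺ʳ e i
  from′ (inj₂ d) = ∈-++⁺ˡ (from f d)

matches-one : ∀ {c} {C : ⊤ → SF → Set} → c represents C tt → Matches [ c ] ⊤ C
matches-one r = (λ _ → here r) , (tt , r) ∷ []

rep-one : ∀ g Δ → (g ∷ Δ) represents (λ f → f ∈ Δ ⊎ f ≡ g)
rep-one g Δ = rep-++ {e = [ g ]} (λ { _ (here e) → e }) (λ { _ e → here e })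

-- `BoxIdx α` ranges over lists in any order and with repetitions, whereas a conclusion depends only
-- on which tests of `α` belong to `ℓ`. So the sublists of `Tests α` represent all conclusions.
box-represents : ∀ Δ α φ {ℓ ℓ′} (s : ℓ ⊆ Tests α) →
  (∀ {τ} → τ ∈ Tests α → τ ∈ ℓ → τ ∈ ℓ′) → (∀ {τ} → τ ∈ Tests α → τ ∈ ℓ′ → τ ∈ ℓ) →
  (map plain (boxExp α φ ℓ′) ++ Δ) represents boxConcl Δ α φ (ℓ , s)
box-represents Δ α φ {ℓ} {ℓ′} s ℓ→ℓ′ ℓ′→ℓ = rep-++ to from
  where
  F? = λ τ → ¬? (τ ∈F? ℓ′)
  P-mono : ∀ {ℓ ℓ′ ds} → (∀ {τ} → τ ∈ Tests α → τ ∈ ℓ → τ ∈ ℓ′) → P ℓ α ds → P ℓ′ α ds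
  P-mono ℓ→ℓ′ p with P⇒H p
  ... | X , h , s = H⇒P h (λ i → ℓ→ℓ′ (H-tests h i) (All.lookup s i))
  to : ∀ f → f ∈ map plain (boxExp α φ ℓ′) → _
  to f i with ∈-map⁻ plain i
  ... | ψ , j , refl with ∈-++⁻ (map ~_ (filter F? (Tests α))) j
  ...   | inj₁ k with ∈-map⁻ ~_ k
  ...     | τ , l , refl with ∈-filter⁻ F? l
  ...       | t , ne = inj₁ (τ , t , (λ m → ne (ℓ→ℓ′ t m)) , refl)
  to f i | ψ , j , refl | inj₂ k with ∈-map⁻ (λ ds → boxes ds φ) k
  ... | ds , l , refl = inj₂ (ds , P-mono ℓ′→ℓ (∈listP⁻ α l) , refl)
  from : ∀ f → _ → f ∈ map plain (boxExp α φ ℓ′)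
  from f (inj₁ (τ , t , ne , refl)) =
    ∈-map⁺ plain (∈-++⁺ˡ (∈-map⁺ ~_ (∈-filter⁺ F? t (λ m → ne (ℓ′→ℓ t m)))))
  from f (inj₂ (ds , p , refl)) =
    ∈-map⁺ plain (∈-++⁺ʳ _ (∈-map⁺ (λ ds → boxes ds φ) (∈listP⁺ (P-mono ℓ→ℓ′ p))))

expansion : Seq → SF → List SF → Seq
expansion X f e = e ++ (X ∖ f)

-- One interface for the six local rules. The facts about `k` say that the step is permitted right
-- after (L+) and that its children do not count as products of (L+).
rule-expand : ∀ {X f} → f ∈ X → wt⁺ (unload f) ≢ 0 →
  Σ RuleKind λ k → k ≢ rL- × isL+ k ≡ false × RuleInst k X (map (expansion X f) (exp f))
rule-expand {X} {f@(plain (~ ~ φ))} i ne =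
  rNeg , (λ ()) , refl , X ∖ f , f , ∉-∖ X f , ∖-≈ i , _ , _ , aNeg φ , matches-one (rep-one _ _)
rule-expand {X} {f@(plain (φ ⋀ ψ))} i ne =
  rAnd , (λ ()) , refl , X ∖ f , f , ∉-∖ X f , ∖-≈ i , _ , _ , aAnd φ ψ ,
  matches-one (rep-++ {e = plain φ ∷ plain ψ ∷ []}
    (λ { _ (here e) → inj₁ e ; _ (there (here e)) → inj₂ e })
    (λ { _ (inj₁ e) → here e ; _ (inj₂ e) → there (here e) }))
rule-expand {X} {f@(plain (~ (φ ⋀ ψ)))} i ne =
  rNAnd , (λ ()) , refl , X ∖ f , f , ∉-∖ X f , ∖-≈ i , _ , _ , aNAnd φ ψ ,
  (λ { true → here (rep-one _ _) ; false → there (here (rep-one _ _)) }) ,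
  (true , rep-one _ _) ∷ (false , rep-one _ _) ∷ []
rule-expand {X} {f@(plain (⟦ α ⟧ φ))} i ne =
  rBox , (λ ()) , refl , X ∖ f , f , ∉-∖ X f , ∖-≈ i , _ , _ , aBox α φ (wtBox≢0 α ne) , every , All.tabulate only
  where
  Δ = X ∖ f
  every : ∀ i → Any (λ c → c represents boxConcl Δ α φ i) (map (expansion X f) (exp f))
  every (ℓ , s) = lose
    (∈-map⁺ (expansion X f) (∈-map⁺ (map plain) (∈-map⁺ (boxExp α φ) (filter∈subs (_∈F? ℓ) (Tests α)))))
    (box-represents Δ α φ s (λ t m → ∈-filter⁺ (_∈F? ℓ) t m)
                            (λ _ m → proj₂ (∈-filter⁻ (_∈F? ℓ) {xs = Tests α} m)))
  only : ∀ {c} → c ∈ map (expansion X f) (exp f) → ∃[ i ] (c represents boxConcl Δ α φ i)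
  only j with ∈-map⁻ (expansion X f) j
  ... | _ , k , refl with ∈-map⁻ (map plain) k
  ...   | _ , l , refl with ∈-map⁻ (boxExp α φ) l
  ...     | ℓ , m , refl = (ℓ , ∈subs⇒⊆ (Tests α) m) , box-represents Δ α φ (∈subs⇒⊆ (Tests α) m) (λ _ → id) (λ _ → id)
rule-expand {X} {f@(plain (~ (⟦ α ⟧ φ)))} i ne =
  rDia , (λ ()) , refl , X ∖ f , f , ∉-∖ X f , ∖-≈ i , _ , _ , aDia α φ (wtBox≢0 α ne) , every , All.tabulate only
  where
  Δ = X ∖ f
  represent : ∀ Y ds h → (map plain (Y ++ [ ~ boxes ds φ ]) ++ Δ) represents diaConcl Δ α φ ((Y , ds) , h)
  represent Y ds h = rep-++ to from
    where
    to : ∀ g → g ∈ map plain (Y ++ [ ~ boxes ds φ ]) → g ∈ map plain Y ⊎ g ≡ plain (~ boxes ds φ)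
    to g j with ∈-map⁻ plain j
    ... | ψ , k , refl with ∈-++⁻ Y k
    ...   | inj₁ l = inj₁ (∈-map⁺ plain l)
    ...   | inj₂ (here e) = inj₂ (cong plain e)
    from : ∀ g → g ∈ map plain Y ⊎ g ≡ plain (~ boxes ds φ) → g ∈ map plain (Y ++ [ ~ boxes ds φ ])
    from g (inj₁ j) with ∈-map⁻ plain j
    ... | ψ , k , refl = ∈-map⁺ plain (∈-++⁺ˡ k)
    from g (inj₂ refl) = ∈-map⁺ plain (∈-++⁺ʳ Y (here refl))
  every : ∀ i → Any (λ c → c represents diaConcl Δ α φ i) (map (expansion X f) (exp f))
  every ((Y , ds) , h) = lose (∈-map⁺ (expansion X f) (∈-map⁺ (map plain) (∈-map⁺ _ (enumH-complete h)))) (represent Y ds h)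
  only : ∀ {c} → c ∈ map (expansion X f) (exp f) → ∃[ i ] (c represents diaConcl Δ α φ i)
  only j with ∈-map⁻ (expansion X f) j
  ... | _ , k , refl with ∈-map⁻ (map plain) k
  ...   | _ , l , refl with ∈-map⁻ _ l
  ...     | (Y , ds) , m , refl = ((Y , ds) , enumH-sound α m) , represent Y ds (enumH-sound α m)
rule-expand {X} {f@(lneg α βs φ)} i ne =
  rLDia , (λ ()) , refl , X ∖ f , f , ∉-∖ X f , ∖-≈ i , _ , _ , aLDia α βs φ (wtBox≢0 α ne) , every , All.tabulate only
  where
  Δ = X ∖ f
  represent : ∀ Y ds h → ((map plain Y ++ [ negU (ds ++ βs) φ ]) ++ Δ) represents ldiaConcl Δ α βs φ ((Y , ds) , h)
  represent Y ds h = rep-++ to from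
    where
    to : ∀ g → g ∈ map plain Y ++ [ negU (ds ++ βs) φ ] → g ∈ map plain Y ⊎ g ≡ negU (ds ++ βs) φ
    to g j with ∈-++⁻ (map plain Y) j
    ... | inj₁ k        = inj₁ k
    ... | inj₂ (here e) = inj₂ e
    from : ∀ g → g ∈ map plain Y ⊎ g ≡ negU (ds ++ βs) φ → g ∈ map plain Y ++ [ negU (ds ++ βs) φ ]
    from g (inj₁ j) = ∈-++⁺ˡ j
    from g (inj₂ e) = ∈-++⁺ʳ (map plain Y) (here e)
  every : ∀ i → Any (λ c → c represents ldiaConcl Δ α βs φ i) (map (expansion X f) (exp f))
  every ((Y , ds) , h) = lose (∈-map⁺ (expansion X f) (∈-map⁺ _ (enumH-complete h))) (represent Y ds h)
  only : ∀ {c} → c ∈ map (expansion X f) (exp f) → ∃[ i ] (c represents ldiaConcl Δ α βs φ i)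
  only j with ∈-map⁻ (expansion X f) j
  ... | _ , k , refl with ∈-map⁻ _ k
  ...   | (Y , ds) , m , refl = ((Y , ds) , enumH-sound α m) , represent Y ds (enumH-sound α m)
rule-expand {f = plain bot} i ne = ⊥-elim (ne refl)
rule-expand {f = plain (var _)} i ne = ⊥-elim (ne refl)
rule-expand {f = plain (~ bot)} i ne = ⊥-elim (ne refl)
rule-expand {f = plain (~ var _)} i ne = ⊥-elim (ne refl)

arg : ℕ → SF → Seq
arg a (plain (⟦ atm b ⟧ ψ)) with a ≟ℕ b
... | yes _ = [ plain ψ ]
... | no _  = []
arg a _ = []

args : ℕ → Seq → Seq
args a = concatMap (arg a)

∈-args⁺ : ∀ {a ψ Δ} → plain (⟦ atm a ⟧ ψ) ∈ Δ → plain ψ ∈ args a Δ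
∈-args⁺ {a} {ψ} i = ∈-concatMap (arg a) i arg-self
  where
  arg-self : plain ψ ∈ arg a (plain (⟦ atm a ⟧ ψ))
  arg-self with a ≟ℕ a
  ... | yes _ = here refl
  ... | no ne = ⊥-elim (ne refl)

arg⁻ : ∀ a g {f} → f ∈ arg a g → ∃[ ψ ] (f ≡ plain ψ × g ≡ plain (⟦ atm a ⟧ ψ))
arg⁻ a (plain (⟦ atm b ⟧ ψ)) j with a ≟ℕ b
arg⁻ a (plain (⟦ atm b ⟧ ψ)) (here refl) | yes refl = ψ , refl , refl

∈-args⁻ : ∀ {a f} Δ → f ∈ args a Δ → ∃[ ψ ] (f ≡ plain ψ × plain (⟦ atm a ⟧ ψ) ∈ Δ)
∈-args⁻ {a} Δ i with find (∈-concatMap⁻ (arg a) {xs = Δ} i)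
... | g , j , k with arg⁻ a g k
...   | ψ , e , refl = ψ , e , j

modalChild : Seq → ℕ → List Prog → Form → Seq
modalChild X a βs φ = negU βs φ ∷ args a (X ∖ lneg (atm a) βs φ)

rule-load : ∀ {X} a αs φ → let f = plain (~ boxes (atm a ∷ αs) φ) in
  f ∈ X → NotBox φ → FreeS (X ∖ f) → All Basic (X ∖ f) → RuleInst rL+ X [ lneg (atm a) αs φ ∷ (X ∖ f) ]
rule-load {X} a αs φ i nb fr ba = X ∖ f , f , ∉-∖ X f , ∖-≈ i , _ , _ , aL+ a αs φ nb fr ba , matches-one (rep-one _ _)
  where f = plain (~ boxes (atm a ∷ αs) φ)

rule-unload : ∀ {X} α αs φ → let f = lneg α αs φ in
  f ∈ X → All Basic (X ∖ f) → RuleInst rL- X [ plain (~ boxes (α ∷ αs) φ) ∷ (X ∖ f) ]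
rule-unload {X} α αs φ i ba = X ∖ f , f , ∉-∖ X f , ∖-≈ i , _ , _ , aL- α αs φ ba , matches-one (rep-one _ _)
  where f = lneg α αs φ

rule-modal : ∀ {X} a βs φ → let f = lneg (atm a) βs φ in
  f ∈ X → All Basic (X ∖ f) → RuleInst rM X [ modalChild X a βs φ ]
rule-modal {X} a βs φ i ba = X ∖ f , f , ∉-∖ X f , ∖-≈ i , _ , _ , aM a βs φ ba ,
  matches-one (λ g → (λ { (here e) → inj₂ e ; (there j) → inj₁ (∈-args⁻ (X ∖ f) j) })
                   , (λ { (inj₂ e) → here e ; (inj₁ (ψ , refl , j)) → there (∈-args⁺ j) }))
  where f = lneg (atm a) βs φ

-- A calculus without restrictions on free repeats.

isLoaded? : ∀ f → Dec (IsLoaded f)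
isLoaded? (plain _)    = no λ ()
isLoaded? (lneg _ _ _) = yes isL

loaded? : ∀ X → Dec (Loaded X)
loaded? = any? isLoaded?

-- Free nodes are not recorded and erase what came before, because a loaded path never passes
-- through one.
nextHist : Seq → List Seq → List Seq
nextHist X h with loaded? X
... | yes _ = X ∷ h
... | no _  = []

-- In contrast to ClosedTab, the history h goes back only to the last free ancestor,
-- a repeat need not be a leaf, and the type is small.
data Tab (h : List Seq) (b : Bool) (X : Seq) : Set where
  tClosed : ClosedSeq X → Tab h b X
  tRepeat : Loaded X → Any (_≈ₛ X) h → Tab h b X
  tExpand : ∀ f → f ∈ X → wt⁺ (unload f) ≢ 0 →
            (∀ e → e ∈ exp f → Tab (nextHist X h) false (expansion X f e)) → Tab h b X
  tLoad   : ∀ a αs φ → let f = plain (~ boxes (atm a ∷ αs) φ) in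
            f ∈ X → NotBox φ → FreeS (X ∖ f) → All Basic (X ∖ f) →
            Tab (nextHist X h) true (lneg (atm a) αs φ ∷ (X ∖ f)) → Tab h b X
  tUnload : b ≡ false → ∀ α αs φ → let f = lneg α αs φ in
            f ∈ X → All Basic (X ∖ f) →
            Tab (nextHist X h) false (plain (~ boxes (α ∷ αs) φ) ∷ (X ∖ f)) → Tab h b X
  tModal  : ∀ a βs φ → let f = lneg (atm a) βs φ in
            f ∈ X → All Basic (X ∖ f) →
            Tab (nextHist X h) false (modalChild X a βs φ) → Tab h b X

nextHist-loaded : ∀ {X} h → Loaded X → nextHist X h ≡ X ∷ h
nextHist-loaded {X} h l with loaded? X
... | yes _ = refl
... | no fr = ⊥-elim (fr l)

nextHist-free : ∀ {X} h → FreeS X → nextHist X h ≡ []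
nextHist-free {X} h fr with loaded? X
... | yes l = ⊥-elim (fr l)
... | no _  = refl

-- A free node is no loaded repeat and passes an empty history to its children, so `h` is never
-- consulted.
Tab-free : ∀ {h h′ b X} → FreeS X → Tab h b X → Tab h′ b X
Tab-free {h} {h′} {b} {X} fr = go
  where
  same : ∀ {b′ Y} → Tab (nextHist X h) b′ Y → Tab (nextHist X h′) b′ Y
  same {b′} {Y} = subst (λ l → Tab l b′ Y) (trans (nextHist-free h fr) (sym (nextHist-free h′ fr)))
  go : Tab h b X → Tab h′ b X
  go (tClosed c) = tClosed c
  go (tRepeat l _) = ⊥-elim (fr l)
  go (tExpand f i ne ts) = tExpand f i ne (λ e j → same (ts e j))
  go (tLoad a αs φ i nb fr′ ba t) = tLoad a αs φ i nb fr′ ba (same t)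
  go (tUnload e α αs φ i ba t) = tUnload e α αs φ i ba (same t)
  go (tModal a βs φ i ba t) = tModal a βs φ i ba (same t)

-- From the calculus to closed PDL-tableaux.

≈-sym : ∀ {X Y} → X ≈ₛ Y → Y ≈ₛ X
≈-sym e f = proj₂ (e f) , proj₁ (e f)

≈-trans : ∀ {X Y Z} → X ≈ₛ Y → Y ≈ₛ Z → X ≈ₛ Z
≈-trans e e′ f = proj₁ (e′ f) ∘ proj₁ (e f) , proj₂ (e f) ∘ proj₂ (e′ f)

_≈?_ : ∀ X Y → Dec (X ≈ₛ Y)
X ≈? Y = map′ (λ { (p , q) f → All.lookup p , All.lookup q })
              (λ e → All.tabulate (λ {f} → proj₁ (e f)) , All.tabulate (λ {f} → proj₂ (e f)))
              (all? (_∈S? Y) X ×-dec all? (_∈S? X) Y)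

Loaded-≈ : ∀ {X Y} → X ≈ₛ Y → Loaded X → Loaded Y
Loaded-≈ e l with find l
... | f , i , isl = lose (proj₁ (e f) i) isl

-- The matching node need not be the nearest one. This recursive form is easier to transport than
-- `LPRepeat`; `toRepeat` recovers the nearest companion.
LoadedPath : List Seq → Seq → Set
LoadedPath []       X = ⊥
LoadedPath (Y ∷ hs) X = Loaded Y × (Y ≈ₛ X ⊎ LoadedPath hs X)

toRepeat : ∀ {hs X} → Loaded X → LoadedPath hs X → LPRepeat hs X
toRepeat {Y ∷ hs} {X} l (lY , p) with Y ≈? X
... | yes e = [] , Y , hs , refl , e , [] , l , [] , lY
toRepeat {Y ∷ hs} {X} l (lY , inj₁ e) | no ne = ⊥-elim (ne e)
toRepeat {Y ∷ hs} {X} l (lY , inj₂ p) | no ne with toRepeat l p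
... | pre , Z , post , refl , e , nes , _ , ls , lZ = Y ∷ pre , Z , post , refl , e , ne ∷ nes , l , lY ∷ ls , lZ

fromRepeat : ∀ {hs X} → LPRepeat hs X → LoadedPath hs X
fromRepeat ([] , Y , post , refl , e , _ , _ , _ , lY) = lY , inj₁ e
fromRepeat (Z ∷ pre , Y , post , refl , e , _ ∷ nes , l , lZ ∷ ls , lY) =
  lZ , inj₂ (fromRepeat (pre , Y , post , refl , e , nes , l , ls , lY))

repeat-loaded : ∀ {hs X} → LPRepeat hs X → Loaded X
repeat-loaded (_ , _ , _ , _ , _ , _ , l , _) = l

LoadedPath-++ : ∀ hs {t X} → LoadedPath hs X → LoadedPath (hs ++ t) X
LoadedPath-++ (Y ∷ hs) (l , inj₁ e) = l , inj₁ e
LoadedPath-++ (Y ∷ hs) (l , inj₂ p) = l , inj₂ (LoadedPath-++ hs p)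

LoadedPath-≈ : ∀ {hs hs′ X X′} → Pointwise _≈ₛ_ hs hs′ → X ≈ₛ X′ → LoadedPath hs X → LoadedPath hs′ X′
LoadedPath-≈ (e ∷ es) eX (l , inj₁ eY) = Loaded-≈ e l , inj₁ (≈-trans (≈-sym e) (≈-trans eY eX))
LoadedPath-≈ (e ∷ es) eX (l , inj₂ p)  = Loaded-≈ e l , inj₂ (LoadedPath-≈ es eX p)

-- No loaded path leads from the node Z, whose nearest ancestors are hs, into the older history t.
Guard : List Seq → List Seq → Seq → Set
Guard hs t Z = FreeS Z ⊎ (Any FreeS hs ⊎ (∀ X → ¬ LoadedPath t X))

Guard-child : ∀ {hs t Z c} → Guard hs t Z → Guard (Z ∷ hs) t c
Guard-child (inj₁ fr)        = inj₂ (inj₁ (here fr))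
Guard-child (inj₂ (inj₁ fr)) = inj₂ (inj₁ (there fr))
Guard-child (inj₂ (inj₂ n))  = inj₂ (inj₂ n)

LoadedPath-cut : ∀ hs {t X} → Any FreeS hs ⊎ (∀ X → ¬ LoadedPath t X) → LoadedPath (hs ++ t) X → LoadedPath hs X
LoadedPath-cut []       (inj₂ n) p = ⊥-elim (n _ p)
LoadedPath-cut (Y ∷ hs) g (l , inj₁ e) = l , inj₁ e
LoadedPath-cut (Y ∷ hs) (inj₁ (here fr)) (l , inj₂ p) = ⊥-elim (fr l)
LoadedPath-cut (Y ∷ hs) (inj₁ (there g)) (l , inj₂ p) = l , inj₂ (LoadedPath-cut hs (inj₁ g) p)
LoadedPath-cut (Y ∷ hs) (inj₂ n) (l , inj₂ p) = l , inj₂ (LoadedPath-cut hs (inj₂ n) p)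

repeat-cut : ∀ hs {t Z} → Guard hs t Z → LPRepeat (hs ++ t) Z → LPRepeat hs Z
repeat-cut hs (inj₁ fr) r = ⊥-elim (fr (repeat-loaded r))
repeat-cut hs (inj₂ g)  r = toRepeat (repeat-loaded r) (LoadedPath-cut hs g (fromRepeat r))

repeat-++ : ∀ hs {t Z} → LPRepeat hs Z → LPRepeat (hs ++ t) Z
repeat-++ hs r = toRepeat (repeat-loaded r) (LoadedPath-++ hs (fromRepeat r))

repeat-≈ : ∀ {hs hs′ X X′} → Pointwise _≈ₛ_ hs hs′ → X ≈ₛ X′ → LPRepeat hs X → LPRepeat hs′ X′
repeat-≈ es e r = toRepeat (Loaded-≈ e (repeat-loaded r)) (LoadedPath-≈ es e (fromRepeat r))

freeRepeat-≈ : ∀ {hs hs′ X X′} → Pointwise _≈ₛ_ hs hs′ → X ≈ₛ X′ → FreeRepeat hs X → FreeRepeat hs′ X′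
freeRepeat-≈ es e (fr , a) = fr ∘ Loaded-≈ (≈-sym e) , go es a
  where
  go : ∀ {hs hs′} → Pointwise _≈ₛ_ hs hs′ → Any (_≈ₛ _) hs → Any (_≈ₛ _) hs′
  go (e′ ∷ es) (here q)  = here (≈-trans (≈-sym e′) (≈-trans q e))
  go (e′ ∷ es) (there a) = there (go es a)

closed-≈ : ∀ {X X′} → X ≈ₛ X′ → ClosedSeq X → ClosedSeq X′
closed-≈ e (inj₁ i) = inj₁ (proj₁ (e _) i)
closed-≈ e (inj₂ (φ , i , j)) = inj₂ (φ , proj₁ (e _) i , proj₁ (e _) j)

rule-≈ : ∀ {k X X′ cs} → X ≈ₛ X′ → RuleInst k X cs → RuleInst k X′ cs
rule-≈ e (Δ , f , n , q , rest) = Δ , f , n , ≈-trans (≈-sym e) q , rest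

mutual
  -- The guard confines loaded-path repeats to `hs`, so repeat leaves survive the loss of `t`; a
  -- shorter history has fewer repeats, so inner nodes survive as well. Labels may change along
  -- `≈ₛ`, and the (L+) mark may be dropped but not added.
  forget : ∀ hs {hs′ t b b′ Z Z′} → Guard hs t Z → Pointwise _≈ₛ_ hs hs′ → Z ≈ₛ Z′ → (b′ ≡ true → b ≡ true) →
           ClosedTab (hs ++ t) b Z → ClosedTab hs′ b′ Z′
  forget hs g es e bb (closedLeaf c) = closedLeaf (closed-≈ e c)
  forget hs g es e bb (lprLeaf r) = lprLeaf (repeat-≈ es e (repeat-cut hs g r))
  forget hs {t = t} {Z = Z} {Z′ = Z′} g es e bb (step nr nf k nk cs ri ts) =
    step (λ r → nr (repeat-++ hs (repeat-≈ (symmetric ≈-sym es) (≈-sym e) r)))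
         (λ r → nf (extendFree (freeRepeat-≈ (symmetric ≈-sym es) (≈-sym e) r)))
         k (nk ∘ bb) cs (rule-≈ e ri) (forgetAll (Z ∷ hs) (Guard-child g) (e ∷ es) ts)
    where
    extendFree : FreeRepeat hs Z → FreeRepeat (hs ++ t) Z
    extendFree (fr , a) = fr , Any-++⁺ˡ a

  forgetAll : ∀ hs {hs′ t b cs} → (∀ {c} → Guard hs t c) → Pointwise _≈ₛ_ hs hs′ →
              All (ClosedTab (hs ++ t) b) cs → All (ClosedTab hs′ b) cs
  forgetAll hs g es [] = []
  forgetAll hs g es (t ∷ ts) = forget hs g es (λ _ → id , id) id t ∷ forgetAll hs g es ts

-- A node that repeats a free sequent of t would yield a closed tableau for that sequent,
-- with its history forgotten.
mutual
  extend : ∀ hs {t b Z} → (∀ {Y} → Y ∈ t → FreeS Y → ¬ ClosedTab [] false Y) → Guard hs t Z →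
           ClosedTab hs b Z → ¬ ¬ ClosedTab (hs ++ t) b Z
  extend hs no-t g (closedLeaf c) κ = κ (closedLeaf c)
  extend hs no-t g (lprLeaf r) κ = κ (lprLeaf (repeat-++ hs r))
  extend hs {t} {Z = Z} no-t g T@(step nr nf k nk cs ri ts) κ =
    extendAll (Z ∷ hs) no-t (Guard-child g) ts λ ts′ →
    κ (step (nr ∘ repeat-cut hs g) notFree k nk cs ri ts′)
    where
    notFree : ¬ FreeRepeat (hs ++ t) Z
    notFree (fr , a) with Any-++⁻ hs a
    ... | inj₁ a′ = nf (fr , a′)
    ... | inj₂ a′ with find a′
    ...   | Y , i , e = no-t i (fr ∘ Loaded-≈ e) (forget [] (inj₁ fr) [] (≈-sym e) (λ ()) T)

  extendAll : ∀ hs {t b cs} → (∀ {Y} → Y ∈ t → FreeS Y → ¬ ClosedTab [] false Y) → (∀ {c} → Guard hs t c) →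
              All (ClosedTab hs b) cs → ¬ ¬ All (ClosedTab (hs ++ t) b) cs
  extendAll hs no-t g [] κ = κ []
  extendAll hs no-t g (t ∷ ts) κ = extend hs no-t g t λ t′ → extendAll hs no-t g ts λ ts′ → κ (t′ ∷ ts′)

baseHist : Seq → List Seq → List Seq
baseHist X h with loaded? X
... | yes _ = h
... | no _  = []

-- Free nodes are first closed with an empty history and then grafted below their ancestors in
-- `closedStep`, where `extend` accounts for free repeats.
ClosedOver : List Seq → Bool → Seq → Set₁
ClosedOver h b X = ClosedTab (baseHist X h) b X

¬¬All : ∀ {A : Set} {Q : A → Set₁} {xs} → All (λ x → ¬ ¬ Q x) xs → ¬ ¬ All Q xs
¬¬All [] κ = κ []
¬¬All (m ∷ ms) κ = m λ q → ¬¬All ms λ qs → κ (q ∷ qs)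

closedStep : ∀ {h b X cs} k → All Loaded h → (b ≡ true → Loaded X) → (b ≡ true → k ≢ rL-) → RuleInst k X cs →
  All (λ c → ¬ ¬ ClosedOver (nextHist X h) (isL+ k) c) cs → ¬ ¬ ClosedOver h b X
closedStep {h} {b} {X} k lh bl nk ri ts κ with loaded? X
closedStep {h} {b} {X} {cs} k lh bl nk ri ts κ | yes l =
  ¬¬All (All.map regraft ts) λ ts′ →
  -- If `X` is itself a loaded-path repeat, it is closed as a leaf; hence the step may assume that
  -- it is none.
  κ (step (λ r → κ (lprLeaf r)) (λ r → proj₁ r l) k nk cs ri ts′)
  where
  regraft : ∀ {c} → ¬ ¬ ClosedOver (X ∷ h) (isL+ k) c → ¬ ¬ ClosedTab (X ∷ h) (isL+ k) c
  regraft {c} m κ′ with loaded? c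
  ... | yes _ = m κ′
  -- All of `X ∷ h` is loaded, so grafting a free child below it creates no free repeat.
  ... | no fr = m λ t → extend [] (λ i fY → ⊥-elim (fY (All.lookup (l ∷ lh) i))) (inj₁ fr) t κ′
closedStep {b = true} k lh bl nk ri ts κ | no fr = fr (bl refl)
closedStep {b = false} {X} {cs} k lh bl nk ri ts κ | no fr =
  ¬¬All (All.map regraft ts) λ ts′ →
  κ (step (λ r → fr (repeat-loaded r)) (λ { (_ , ()) }) k nk cs ri ts′)
  where
  regraft : ∀ {c} → ¬ ¬ ClosedOver [] (isL+ k) c → ¬ ¬ ClosedTab [ X ] (isL+ k) c
  regraft {c} m κ′ = m λ t →
    -- `κ` refutes closed tableaux for `X`, which is what `extend` demands of the free sequents
    -- above. As `X` is free, no loaded path from below enters the history `[ X ]`.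
    extend [] (λ { (here refl) _ → κ }) (inj₂ (inj₂ (λ { _ (l , _) → fr l }))) (rebase t) κ′
    where
    rebase : ClosedOver [] (isL+ k) c → ClosedTab [] (isL+ k) c
    rebase t with loaded? c
    ... | yes _ = t
    ... | no _  = t

nextHist-All : ∀ {X h} → All Loaded h → All Loaded (nextHist X h)
nextHist-All {X} lh with loaded? X
... | yes l = l ∷ lh
... | no _  = []

Tab⇒Closed : ∀ {h b X} → All Loaded h → (b ≡ true → Loaded X) → Tab h b X → ¬ ¬ ClosedOver h b X
Tab⇒Closed lh bl (tClosed c) κ = κ (closedLeaf c)
Tab⇒Closed {h} {b} {X} lh bl (tRepeat l a) κ with loaded? X
... | yes _ = κ (lprLeaf (toRepeat l (path lh a)))
  where
  path : ∀ {h} → All Loaded h → Any (_≈ₛ X) h → LoadedPath h X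
  path (l ∷ _)  (here e)  = l , inj₁ e
  path (l ∷ lh) (there a) = l , inj₂ (path lh a)
... | no fr = fr l
Tab⇒Closed {h} {b} {X} lh bl (tExpand f i ne ts) with rule-expand i ne
... | k , k≢ , k≡ , ri = closedStep k lh bl (λ _ → k≢) ri (All.tabulate child)
  where
  child : ∀ {c} → c ∈ map (expansion X f) (exp f) → ¬ ¬ ClosedOver (nextHist X h) (isL+ k) c
  child j with ∈-map⁻ (expansion X f) j
  ... | e , m , refl rewrite k≡ = Tab⇒Closed (nextHist-All lh) (λ ()) (ts e m)
Tab⇒Closed lh bl (tLoad a αs φ i nb fr ba t) =
  closedStep rL+ lh bl (λ _ ()) (rule-load a αs φ i nb fr ba) (Tab⇒Closed (nextHist-All lh) (λ _ → here isL) t ∷ [])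
Tab⇒Closed lh bl (tUnload refl α αs φ i ba t) =
  closedStep rL- lh bl (λ ()) (rule-unload α αs φ i ba) (Tab⇒Closed (nextHist-All lh) (λ ()) t ∷ [])
Tab⇒Closed lh bl (tModal a βs φ i ba t) =
  closedStep rM lh bl (λ _ ()) (rule-modal a βs φ i ba) (Tab⇒Closed (nextHist-All lh) (λ ()) t ∷ [])

-- Saturation.

Saturated : List Form → Set
Saturated S = ∀ {φ} → φ ∈ S → wt⁺ φ ≢ 0 → ∃[ e ] (e ∈ expF φ × e ⊆ S)

-- Loc S φ γs δs: in executing γs with goal ¬φ, the list δs remains when S is left.
data Loc (S : List Form) (φ : Form) : List Prog → List Prog → Set where
  done : ∀ {γs} → Loc S φ γs γs
  unf  : ∀ {α X ds βs δs} → H α X ds → X ⊆ S → ~ boxes (ds ++ βs) φ ∈ S →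
         Loc S φ (ds ++ βs) δs → Loc S φ (α ∷ βs) δs

Loc-mono : ∀ {S S′ φ γs δs} → S ⊆ S′ → Loc S φ γs δs → Loc S′ φ γs δs
Loc-mono s done          = done
Loc-mono s (unf h X i l) = unf h (s ∘ X) (s i) (Loc-mono s l)

Loc-goal : ∀ {S φ γs δs} → ~ boxes γs φ ∈ S → Loc S φ γs δs → ~ boxes δs φ ∈ S
Loc-goal i done          = i
Loc-goal i (unf _ _ j l) = Loc-goal j l

Loc-[] : ∀ {S φ δs} → Loc S φ [] δs → δs ≡ []
Loc-[] done = refl

-- Every loaded formula of Y is ¬[γs]φ, which is present unless γs is empty.
Track : Form → List Prog → Seq → Set
Track φ γs Y = (∀ {α βs} → γs ≡ α ∷ βs → negU γs φ ∈ Y) × (∀ {f} → f ∈ Y → IsLoaded f → f ≡ negU γs φ)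

Track-free : ∀ {φ Y} → Track φ [] Y → FreeS Y
Track-free t l with find l
... | f , i , isl with proj₂ t i isl
Track-free t l | _ , i , () | refl

¬¬pick : {A : Set} {Q : A → Set} (xs : List A) → ¬ (∀ x → x ∈ xs → Q x) → ¬ ¬ (∃[ x ] (x ∈ xs × ¬ Q x))
¬¬pick [] n κ = n (λ _ ())
¬¬pick {Q = Q} (x ∷ xs) n κ = κ (x , here refl , λ q →
  ¬¬pick {Q = Q} xs (λ all → n (λ { _ (here refl) → q ; y (there i) → all y i }))
    (λ { (y , i , nq) → κ (y , there i , nq) }))

plain-free : ∀ {X f} → f ∈ map plain X → ¬ IsLoaded f
plain-free i isl with ∈-map⁻ plain i
plain-free i () | _ , _ , refl

─-Any : {A : Set} {Q Q′ : A → Set} (xs : List A) (a : Any Q xs) → Any Q′ xs →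
        (∃[ x ] (Q x × Q′ x)) ⊎ Any Q′ (xs ─ a)
─-Any (x ∷ xs) (here q)  (here q′)  = inj₁ (x , q , q′)
─-Any (x ∷ xs) (here q)  (there a′) = inj₂ a′
─-Any (x ∷ xs) (there a) (here q′)  = inj₂ (here q′)
─-Any (x ∷ xs) (there a) (there a′) with ─-Any xs a a′
... | inj₁ p = inj₁ p
... | inj₂ b = inj₂ (there b)

-- All ways to write the formula as `boxes βs ψ`. Loading may stop after any box, so a formula has
-- several loaded versions, but only finitely many; this makes the sequents over `Cl` enumerable.
splits : Form → List (List Prog × Form)
splits (⟦ α ⟧ φ) = ([] , ⟦ α ⟧ φ) ∷ map (λ { (βs , ψ) → α ∷ βs , ψ }) (splits φ)
splits φ         = [ ([] , φ) ]

∈-splits : ∀ βs φ → (βs , φ) ∈ splits (boxes βs φ)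
∈-splits [] bot         = here refl
∈-splits [] (var _)     = here refl
∈-splits [] (~ _)       = here refl
∈-splits [] (_ ⋀ _)     = here refl
∈-splits [] (⟦ _ ⟧ _)   = here refl
∈-splits (β ∷ βs) φ     = there (∈-map⁺ (λ { (βs , ψ) → β ∷ βs , ψ }) (∈-splits βs φ))

loads : Form → List SF
loads (~ ⟦ α ⟧ φ) = map (λ { (βs , ψ) → lneg α βs ψ }) (splits φ)
loads _           = []

module Completeness (Cl : List Form) (closed : RuleClosed Cl) where

  open RuleClosed closed renaming (expand to Cl-expand; box to Cl-box; dia to Cl-dia)

  InCl : Seq → Set
  InCl Y = ∀ {f} → f ∈ Y → unload f ∈ Cl

  -- The contents of worlds. The local rules decompose `S` down to `base`, and by `core` the
  -- consistent sequent `base` contains all basic formulas of `S`; so `S` has no clash among these,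
  -- and (L+) can start from any of its atomic diamonds.
  record Good (S : List Form) : Set where
    field
      saturated : Saturated S
      base      : Seq
      cons      : ¬ Tab [] false base
      basic     : All Basic base
      free      : FreeS base
      inCl      : InCl base
      core      : ∀ {φ} → φ ∈ S → wt⁺ φ ≡ 0 → plain φ ∈ base

  Good-≈ : ∀ {S S′} → S ⊆ S′ → S′ ⊆ S → Good S → Good S′
  Good-≈ s s′ g = record
    { saturated = λ i ne → let (e , j , k) = saturated (s′ i) ne in e , j , λ m → s (k m)
    ; base = base ; cons = cons ; basic = basic ; free = free ; inCl = inCl
    ; core = λ i → core (s′ i) }
    where open Good g

  -- What is left after exhausting the local rules from `Y`. The fields `loc` and `track` follow the
  -- loaded formula from `γs` to `δs`. The old history survives in `h′` only if `B` is loaded, for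
  -- then no node on the way was free.
  record Saturation (h : List Seq) (Y : Seq) (φ : Form) (γs : List Prog) : Set where
    field
      S         : List Form
      B         : Seq
      h′        : List Seq
      δs        : List Prog
      cons      : ¬ Tab h′ false B
      basic     : All Basic B
      inCl      : InCl B
      S⊆Cl      : S ⊆ Cl
      hist      : Loaded B → h ⊆ h′
      Y⊆S       : ∀ {f} → f ∈ Y → unload f ∈ S
      saturated : Saturated S
      core      : ∀ {ψ} → ψ ∈ S → wt⁺ ψ ≡ 0 → ∃[ f ] (f ∈ B × unload f ≡ ψ)
      loc       : Loc S φ γs δs
      track     : Track φ δs B

  record Expansion (Y : Seq) (φ : Form) (f : SF) (e : List SF) (γs : List Prog) : Set where
    field
      γs′   : List Prog
      track : Track φ γs′ (expansion Y f e)
      back  : ∀ {S δs} → (∀ {g} → g ∈ e → unload g ∈ S) → Loc S φ γs′ δs → Loc S φ γs δs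

  track-expand : ∀ {Y φ γs} f {e} → f ∈ Y → e ∈ exp f → Track φ γs Y → Expansion Y φ f e γs
  track-expand {Y} {φ} {γs} (plain ψ) {e} f∈Y i (tr₁ , tr₂) = record
    { γs′ = γs
    ; track = (λ { refl → ∈-++⁺ʳ e (∈-∖⁺ (tr₁ refl) (λ ())) }) , unique
    ; back = λ _ l → l }
    where
    unique : ∀ {g} → g ∈ expansion Y (plain ψ) e → IsLoaded g → g ≡ negU γs φ
    unique j isl with ∈-++⁻ e j
    ... | inj₂ k = tr₂ (proj₁ (∈-∖⁻ Y k)) isl
    ... | inj₁ k with ∈-map⁻ (map plain) i
    ...   | _ , _ , refl = ⊥-elim (plain-free k isl)
  track-expand {γs = []} (lneg α βs ψ) f∈Y i (tr₁ , tr₂) with tr₂ f∈Y isL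
  ... | ()
  track-expand {Y} {φ} {γs = γ ∷ γs} f@(lneg α βs ψ) f∈Y i (tr₁ , tr₂) with tr₂ f∈Y isL
  ... | refl with ∈-map⁻ _ i
  ...   | (X , ds) , j , refl = record
    { γs′ = ds ++ βs
    ; track = (λ _ → ∈-++⁺ˡ (∈-++⁺ʳ (map plain X) (here refl))) , unique
    ; back = λ {S} s l → unf (enumH-sound α j) (λ m → s (∈-++⁺ˡ (∈-map⁺ plain m)))
        (subst (_∈ S) (unload-negU (ds ++ βs) φ) (s (∈-++⁺ʳ (map plain X) (here refl)))) l }
    where
    unique : ∀ {g} → g ∈ expansion Y f (map plain X ++ [ negU (ds ++ βs) φ ]) → IsLoaded g → g ≡ negU (ds ++ βs) φ
    unique k isl with ∈-++⁻ (map plain X ++ [ negU (ds ++ βs) φ ]) k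
    ... | inj₂ l = ⊥-elim (proj₂ (∈-∖⁻ Y l) (tr₂ (proj₁ (∈-∖⁻ Y l)) isl))
    ... | inj₁ l with ∈-++⁻ (map plain X) l
    ...   | inj₁ m = ⊥-elim (plain-free m isl)
    ...   | inj₂ (here e) = e

  saturate : ∀ n h Y φ γs → weight Y < n → ¬ Tab h false Y → InCl Y → Track φ γs Y → ¬ ¬ Saturation h Y φ γs
  saturate (suc n) h Y φ γs (s≤s lt) nt inC tr κ with any? (λ f → ¬? (wt⁺ (unload f) ≟ℕ 0)) Y
  ... | no none = κ record
    { S = map unload Y ; B = Y ; h′ = h ; δs = γs ; cons = nt
    ; basic = All.tabulate (λ {f} i → zero⇒Basic f (zero-wt i))
    ; inCl = inC
    ; S⊆Cl = λ i → let (f , j , e) = ∈-map⁻ unload i in subst (_∈ Cl) (sym e) (inC j)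
    ; hist = λ _ i → i
    ; Y⊆S = ∈-map⁺ unload
    ; saturated = λ i ne → let (f , j , e) = ∈-map⁻ unload i in ⊥-elim (ne (trans (cong wt⁺ e) (zero-wt j)))
    ; core = λ i _ → let (f , j , e) = ∈-map⁻ unload i in f , j , sym e
    ; loc = done ; track = tr }
    where
    zero-wt : ∀ {f} → f ∈ Y → wt⁺ (unload f) ≡ 0
    zero-wt {f} i = decidable-stable (wt⁺ (unload f) ≟ℕ 0) (λ ne → none (lose i ne))
  ... | yes some with find some
  ...   | f , f∈Y , ne =
    ¬¬pick (exp f) (λ all → nt (tExpand f f∈Y ne all)) λ { (e , i , nt′) → child e i nt′ }
    where
    child : ∀ e → e ∈ exp f → ¬ Tab (nextHist Y h) false (expansion Y f e) → ⊥
    child e i nt′ =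
      saturate n (nextHist Y h) Y′ φ (Expansion.γs′ x) (≤-trans (expand-weight f∈Y ne i) lt) nt′ inC′ (Expansion.track x) λ r →
      κ (record
        { S = unload f ∷ Saturation.S r ; B = Saturation.B r ; h′ = Saturation.h′ r ; δs = Saturation.δs r
        ; cons = Saturation.cons r ; basic = Saturation.basic r ; inCl = Saturation.inCl r
        ; S⊆Cl = λ { (here refl) → inC f∈Y ; (there j) → Saturation.S⊆Cl r j }
        ; hist = λ l j → Saturation.hist r l (subst (_ ∈_) (sym (nextHist-loaded h (loadedY r l))) (there j))
        ; Y⊆S = Y⊆ r
        ; saturated = λ { (here refl) _ → map unload e , exp-unload f i , λ j → there (e⊆ r j)
                        ; (there j) ne′ → let (e′ , k , s) = Saturation.saturated r j ne′ in e′ , k , λ m → there (s m) }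
        ; core = λ { (here refl) z → ⊥-elim (ne z) ; (there j) z → Saturation.core r j z }
        ; loc = loc r
        ; track = Saturation.track r })
      where
      Y′ = expansion Y f e
      x = track-expand f f∈Y i tr
      inC′ : InCl Y′
      inC′ j with ∈-++⁻ e j
      ... | inj₁ k = Cl-expand (inC f∈Y) (exp-unload f i) (∈-map⁺ unload k)
      ... | inj₂ k = inC (proj₁ (∈-∖⁻ Y k))
      R = Saturation (nextHist Y h) Y′ φ (Expansion.γs′ x)
      e⊆ : (r : R) → map unload e ⊆ Saturation.S r
      e⊆ r j with ∈-map⁻ unload j
      ... | g , k , refl = Saturation.Y⊆S r (∈-++⁺ˡ k)
      loc : (r : R) → Loc (unload f ∷ Saturation.S r) φ γs (Saturation.δs r)
      loc r = Expansion.back x (λ j → there (e⊆ r (∈-map⁺ unload j))) (Loc-mono there (Saturation.loc r))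
      Y⊆ : (r : R) → ∀ {g} → g ∈ Y → unload g ∈ unload f ∷ Saturation.S r
      Y⊆ r {g} j with g ≟S f
      ... | yes refl = here refl
      ... | no g≢f   = there (Saturation.Y⊆S r (∈-++⁺ʳ e (∈-∖⁺ j g≢f)))
      loadedY : (r : R) → Loaded (Saturation.B r) → Loaded Y
      loadedY r l = from γs tr (loc r)
        where
        from : ∀ γs → Track φ γs Y → Loc _ φ γs (Saturation.δs r) → Loaded Y
        from [] _ lo = ⊥-elim (Track-free (subst (λ δs → Track φ δs _) (Loc-[] lo) (Saturation.track r)) l)
        from (γ ∷ γs) t _ = lose (proj₁ t refl) isL

  -- Runs along loaded paths, which fulfil diamonds.

  data Run (φ : Form) : List Form → List Prog → Set where
    stop : ∀ {S γs} → Good S → Loc S φ γs [] → ~ φ ∈ S → Run φ S γs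
    move : ∀ {S S′ γs a δs} → Good S → Loc S φ γs (atm a ∷ δs) →
           (∀ {ψ} → ⟦ atm a ⟧ ψ ∈ S → ψ ∈ S′) → Run φ S′ δs → Run φ S γs

  Run-good : ∀ {φ S γs} → Run φ S γs → Good S
  Run-good (stop g _ _)   = g
  Run-good (move g _ _ _) = g

  track-modal : ∀ X a βs φ → Track φ βs (modalChild X a βs φ)
  track-modal X a βs φ = (λ _ → here refl) , unique
    where
    unique : ∀ {g} → g ∈ modalChild X a βs φ → IsLoaded g → g ≡ negU βs φ
    unique (here e) _ = e
    unique (there i) isl with ∈-args⁻ (X ∖ lneg (atm a) βs φ) i
    unique (there i) () | _ , refl , _

  inCl-modal : ∀ {X a βs φ} → InCl X → lneg (atm a) βs φ ∈ X → InCl (modalChild X a βs φ)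
  inCl-modal {βs = βs} {φ} inC i (here refl) = subst (_∈ Cl) (sym (unload-negU βs φ)) (Cl-dia (inC i))
  inCl-modal {X} {a} {βs} {φ} inC i (there j) with ∈-args⁻ (X ∖ lneg (atm a) βs φ) j
  ... | ψ , refl , k = Cl-box (inC (proj₁ (∈-∖⁻ X k)))

  good-free : ∀ {h Y φ γs} (r : Saturation h Y φ γs) → FreeS (Saturation.B r) → Good (Saturation.S r)
  good-free r fr = record
    { saturated = saturated ; base = B ; cons = cons ∘ Tab-free fr ; basic = basic ; free = fr ; inCl = inCl
    ; core = λ i z → core′ (core i z) }
    where
    open Saturation r
    core′ : ∀ {ψ} → ∃[ f ] (f ∈ B × unload f ≡ ψ) → plain ψ ∈ B
    core′ (plain _ , i , refl) = i
    core′ (lneg _ _ _ , i , _) = ⊥-elim (fr (lose i isL))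

  -- The base is the result of (L-) applied to `B`, which the mark `false` in `cons` permits. It is
  -- free, so by `Tab-free` a tableau closing it with empty history would also close it below `B`.
  good-loaded : ∀ {h Y φ γs} (r : Saturation h Y φ γs) {a δs} → Saturation.δs r ≡ atm a ∷ δs → Good (Saturation.S r)
  good-loaded {φ = φ} r {a} {δs′} refl = record
    { saturated = saturated ; base = B⁻
    ; cons = λ t → cons (tUnload refl (atm a) δs′ φ f∈B basic′ (Tab-free free⁻ t))
    ; basic = bDia ∷ basic′
    ; free = free⁻
    ; inCl = λ { (here refl) → inCl f∈B ; (there i) → inCl (proj₁ (∈-∖⁻ B i)) }
    ; core = λ i z → core′ (core i z) }
    where
    open Saturation r
    f = lneg (atm a) δs′ φ
    f∈B : f ∈ B
    f∈B = proj₁ track refl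
    B⁻ = plain (~ boxes (atm a ∷ δs′) φ) ∷ (B ∖ f)
    basic′ : All Basic (B ∖ f)
    basic′ = All.tabulate (λ i → All.lookup basic (proj₁ (∈-∖⁻ B i)))
    free⁻ : FreeS B⁻
    free⁻ l with find l
    ... | _ , here refl , ()
    ... | _ , there i , isl = proj₂ (∈-∖⁻ B i) (proj₂ track (proj₁ (∈-∖⁻ B i)) isl)
    core′ : ∀ {ψ} → ∃[ f ] (f ∈ B × unload f ≡ ψ) → plain ψ ∈ B⁻
    core′ (plain _ , i , refl) = there (∈-∖⁺ i (λ ()))
    core′ (lneg _ _ _ , i , refl) with proj₂ track i isL
    ... | refl = here refl

  -- rem contains, up to ≈ₛ, all sequents over Cl that have not yet occurred on the loaded path.
  follow : ∀ n (rem : List Seq) → length rem ≤ n → ∀ h Y φ γs →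
    (∀ B → InCl B → Any (_≈ₛ B) rem ⊎ Any (_≈ₛ B) h) →
    ¬ Tab h false Y → InCl Y → Track φ γs Y → negU γs φ ∈ Y →
    ¬ ¬ (∃[ S ] ((∀ {f} → f ∈ Y → unload f ∈ S) × Run φ S γs))
  follow n rem le h Y φ γs inv nt inC tr g∈Y κ =
    saturate (suc (weight Y)) h Y φ γs ≤-refl nt inC tr λ r → ended r (Saturation.δs r) refl
    where
    ended : (r : Saturation h Y φ γs) → ∀ δs → Saturation.δs r ≡ δs → ⊥
    ended r [] refl = κ (S , Y⊆S , stop (good-free r (Track-free track)) loc
                          (Loc-goal (subst (_∈ S) (unload-negU γs φ) (Y⊆S g∈Y)) loc))
      where open Saturation r
    ended r (δ ∷ δs) eq with All.lookup (Saturation.basic r) (proj₁ (Saturation.track r) eq)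
    ended r (atm a ∷ δs′) refl | _ = fresh n le (inv B inCl)
      where
      open Saturation r
      f = lneg (atm a) δs′ φ
      f∈B : f ∈ B
      f∈B = proj₁ track refl
      lB : Loaded B
      lB = lose f∈B isL
      basic′ : All Basic (B ∖ f)
      basic′ = All.tabulate (λ i → All.lookup basic (proj₁ (∈-∖⁻ B i)))
      monotone : ∀ {B′} → Any (_≈ₛ B′) h → Any (_≈ₛ B′) h′
      monotone a = let (Z , i , e) = find a in lose (hist lB i) e
      fresh : ∀ n → length rem ≤ n → Any (_≈ₛ B) rem ⊎ Any (_≈ₛ B) h → ⊥
      -- A loaded sequent that already occurs in the history would close as a repeat, against its
      -- consistency. So `B` is found in `rem`, and every modal step uses up one entry.
      fresh n le (inj₂ a) = cons (tRepeat lB (monotone a))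
      fresh n le (inj₁ p) with length rem | length-removeAt′ rem (index p)
      fresh (suc n) (s≤s le) (inj₁ p) | _ | refl =
        follow n (rem ─ p) le (B ∷ h′) (modalChild B a δs′ φ) φ δs′ inv′
          (λ t → cons (tModal a δs′ φ f∈B basic′ (subst (λ l → Tab l false _) (sym (nextHist-loaded h′ lB)) t)))
          (inCl-modal inCl f∈B) (track-modal B a δs′ φ) (here refl)
          λ { (S′ , sub , run) → κ (S , Y⊆S , move (good-loaded r refl) loc (λ i → sub (there (link (core i refl)))) run) }
        where
        inv′ : ∀ B′ → InCl B′ → Any (_≈ₛ B′) (rem ─ p) ⊎ Any (_≈ₛ B′) (B ∷ h′)
        inv′ B′ c with inv B′ c
        ... | inj₂ a = inj₂ (there (monotone a))
        ... | inj₁ a with ─-Any rem p a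
        ...   | inj₁ (_ , e , e′) = inj₂ (here (≈-trans (≈-sym e) e′))
        ...   | inj₂ a′ = inj₁ a′
        link : ∀ {ψ} → ∃[ g ] (g ∈ B × unload g ≡ ⟦ atm a ⟧ ψ) → plain ψ ∈ args a (B ∖ f)
        link (plain _ , i , refl) = ∈-args⁺ (∈-∖⁺ i (λ ()))

  allSF : Seq
  allSF = map plain Cl ++ concatMap loads Cl

  ∈-allSF : ∀ f → unload f ∈ Cl → f ∈ allSF
  ∈-allSF (plain φ) i = ∈-++⁺ˡ (∈-map⁺ plain i)
  ∈-allSF (lneg α βs φ) i =
    ∈-++⁺ʳ (map plain Cl) (∈-concatMap loads i (∈-map⁺ (λ { (βs , ψ) → lneg α βs ψ }) (∈-splits βs φ)))

  ∈-allSeq : ∀ B → InCl B → Any (_≈ₛ B) (subs allSF)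
  ∈-allSeq B inC = lose (filter∈subs (_∈S? B) allSF)
    (λ f → (λ i → proj₂ (∈-filter⁻ (_∈S? B) {xs = allSF} i)) , (λ i → ∈-filter⁺ (_∈S? B) (∈-allSF f (inC i)) i))

  unfold-dia : ∀ {S α φ} → Saturated S → NonAtomic α → ~ ⟦ α ⟧ φ ∈ S →
               ∃[ X ] ∃[ ds ] (H α X ds × X ⊆ S × ~ boxes ds φ ∈ S)
  unfold-dia {α = α} sat na i with sat i (nonAtomic≢0 α na)
  ... | e , j , s with ∈-map⁻ _ j
  ...   | (X , ds) , k , refl = X , ds , enumH-sound α k , (λ m → s (∈-++⁺ˡ m)) , s (∈-++⁺ʳ X (here refl))

  -- Saturation unfolds the first program inside `S`. The result starts with an atomic program
  -- unless it is empty, and then the next program of the list is treated.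
  localise : ∀ {S φ} → Saturated S → ∀ γs → ~ boxes γs φ ∈ S → ∃[ δs ] (AtomHead δs × Loc S φ γs δs)
  localise sat [] i = [] , empty , done
  localise {S} {φ} sat (γ ∷ γs) i with atomic? γ
  ... | inj₁ (a , refl) = atm a ∷ γs , head , done
  ... | inj₂ na with unfold-dia sat na i
  ...   | X , ds , h , s , j with H-head h
  ...     | head = _ , head , unf h s (subst (λ χ → ~ χ ∈ S) (sym (boxes-++ ds γs φ)) j) done
  ...     | empty with localise sat γs j
  ...       | δs , ah , l = δs , ah , unf h s j l

  -- The goal is first unfolded inside `S` up to an atomic program. If none remains, the run ends at
  -- `S`; otherwise (L+) loads the goal in `base` and (M) follows at once. `NotBox φ` gives the
  -- maximal loading that (L+) requires.
  exists-run : ∀ {S} → Good S → ∀ γs φ → NotBox φ → ~ boxes γs φ ∈ S → ¬ ¬ Run φ S γs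
  exists-run {S} g γs φ nb i κ with localise (Good.saturated g) γs i
  ... | [] , _ , l = κ (stop g l (Loc-goal i l))
  ... | atm a ∷ δs , head , l =
    -- The free `base` is not recorded, so the history at the modal child is just `c`; `rem` begins
    -- as the list of all sequents over `Cl`.
    follow (length (subs allSF)) (subs allSF) ≤-refl [ c ] (modalChild c a δs φ) φ δs
      (λ B inC → inj₁ (∈-allSeq B inC))
      (λ t → cons (tLoad a δs φ f∈B nb freeΔ basicΔ
        (subst (λ h → Tab h true c) (sym (nextHist-free [] free))
          (tModal a δs φ (here refl) basic-c (subst (λ h → Tab h false (modalChild c a δs φ)) (sym (nextHist-loaded {c} [] (here isL))) t)))))
      (inCl-modal {c} {a} {δs} {φ} inCl-c (here refl)) (track-modal c a δs φ) (here refl)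
      λ { (S′ , sub , run) → κ (move g l (λ j → sub (there (link (core j refl)))) run) }
    where
    open Good g
    f = plain (~ boxes (atm a ∷ δs) φ)
    f∈B : f ∈ base
    f∈B = core (Loc-goal i l) refl
    c = lneg (atm a) δs φ ∷ (base ∖ f)
    basicΔ : All Basic (base ∖ f)
    basicΔ = All.tabulate (λ j → All.lookup basic (proj₁ (∈-∖⁻ base j)))
    freeΔ : FreeS (base ∖ f)
    freeΔ l with find l
    ... | _ , j , isl = free (lose (proj₁ (∈-∖⁻ base j)) isl)
    basic-c : All Basic (c ∖ lneg (atm a) δs φ)
    basic-c = All.tabulate (λ j → All.lookup (bLDia ∷ basicΔ) (proj₁ (∈-∖⁻ c {lneg (atm a) δs φ} j)))
    inCl-c : InCl c
    inCl-c (here refl) = inCl f∈B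
    inCl-c (there j)   = inCl (proj₁ (∈-∖⁻ base j))
    link : ∀ {ψ} → plain (⟦ atm a ⟧ ψ) ∈ base → plain ψ ∈ args a (c ∖ lneg (atm a) δs φ)
    link j = ∈-args⁺ {Δ = c ∖ lneg (atm a) δs φ} (∈-∖⁺ {X = c} {lneg (atm a) δs φ} (there (∈-∖⁺ j (λ ()))) (λ ()))

-- The model.

module Traces (M : Model) where
  open Model M
  open Sem M

  -- Executions cut into unfoldings and atomic steps, the granularity at which worlds know about
  -- programs. `Θ` reads a test as membership in traces obtained from runs, and as truth in those
  -- obtained from `Rel`.
  data Trace (Θ : W → Form → Set) : List Prog → W → W → Set where
    nil : ∀ {w} → Trace Θ [] w w
    unf : ∀ {α X ds γs w v} → H α X ds → (∀ {τ} → τ ∈ X → Θ w τ) → Trace Θ (ds ++ γs) w v → Trace Θ (α ∷ γs) w v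
    stp : ∀ {a γs w u v} → R a w u → Trace Θ γs u v → Trace Θ (atm a ∷ γs) w v

  record Unfolded (α : Prog) (γs : List Prog) (w v : W) : Set where
    constructor unfolded
    field
      {X ds} : _
      H-ds   : H α X ds
      true-X : ∀ {τ} → τ ∈ X → w ⊨ τ
      rest   : Trace _⊨_ (ds ++ γs) w v

  fold : ∀ {α γs w v} → Unfolded α γs w v → Trace _⊨_ (α ∷ γs) w v
  fold (unfolded h t r) = unf h t r

  invert : ∀ {α γs w v} → Trace _⊨_ (α ∷ γs) w v → Unfolded α γs w v
  invert (unf h t r) = unfolded h t r
  invert (stp r t)   = unfolded hAtm (λ ()) (stp r t)

  unfold-Rel : ∀ α {γs w u v} → Rel α w u → Trace _⊨_ γs u v → Unfolded α γs w v
  unfold-Rel (atm a) r t = unfolded hAtm (λ ()) (stp r t)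
  unfold-Rel (τ ¿) (refl , p) t = unfolded hTest (λ { (here refl) → p }) t
  unfold-Rel (α ∪ₚ β) (inj₁ r) t with unfold-Rel α r t
  ... | unfolded h p t′ = unfolded (hUnL h) p t′
  unfold-Rel (α ∪ₚ β) (inj₂ r) t with unfold-Rel β r t
  ... | unfolded h p t′ = unfolded (hUnR h) p t′
  unfold-Rel (α ⨟ β) {γs} {w} {v = v} (x , r , r′) t with unfold-Rel α r (fold (unfold-Rel β r′ t))
  ... | unfolded {ds = d ∷ ds} h p t′ =
    unfolded (hSeqN h) p (subst (λ l → Trace _⊨_ l w v) (sym (++-assoc (d ∷ ds) [ β ] γs)) t′)
  ... | unfolded {X = X} {ds = []} h p t′ with invert t′
  ...   | unfolded {X = Y} h′ p′ t″ = unfolded (hSeqE h h′) both t″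
    where
    both : ∀ {τ} → τ ∈ X ++ Y → w ⊨ τ
    both i with ∈-++⁻ X i
    ... | inj₁ j = p j
    ... | inj₂ j = p′ j
  unfold-Rel (α ✶) {γs} {v = v} r t = star r
    where
    star : ∀ {w} → Star (Rel α) w _ → Unfolded (α ✶) γs w v
    star ε = unfolded hStarE (λ ()) t
    star {w} (r ◅ rs) with unfold-Rel α r (fold (star rs))
    -- An iteration that unfolds to `[]` leaves the rest of the trace at the same world, so it is
    -- skipped; the star case of `H` likewise iterates only nonempty unfoldings of `α`.
    ... | unfolded {ds = []} h p t′ = invert t′
    ... | unfolded {ds = d ∷ ds} h p t′ =
      unfolded (hStarN h) p (subst (λ l → Trace _⊨_ l w v) (sym (++-assoc (d ∷ ds) [ α ✶ ] γs)) t′)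

  Rels : List Prog → W → W → Set
  Rels []       w v = w ≡ v
  Rels (α ∷ αs) w v = ∃[ u ] (Rel α w u × Rels αs u v)

  Rels-++ : ∀ αs {βs w v} → Rels (αs ++ βs) w v → ∃[ u ] (Rels αs w u × Rels βs u v)
  Rels-++ []       r = _ , refl , r
  Rels-++ (α ∷ αs) (x , r , rs) with Rels-++ αs rs
  ... | u , p , q = u , (x , r , p) , q

  H-sound : ∀ {α X ds w v} → H α X ds → (∀ {τ} → τ ∈ X → w ⊨ τ) → Rels ds w v → Rel α w v
  H-sound hAtm t (_ , r , refl) = r
  H-sound hTest t e = e , t (here refl)
  H-sound (hUnL h) t r = inj₁ (H-sound h t r)
  H-sound (hUnR h) t r = inj₂ (H-sound h t r)
  H-sound (hSeqN {d = d} {ds} h) t r with Rels-++ (d ∷ ds) r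
  ... | u , p , (_ , q , refl) = u , H-sound h t p , q
  H-sound (hSeqE {X = X} h k) t r = _ , H-sound h (t ∘ ∈-++⁺ˡ) refl , H-sound k (t ∘ ∈-++⁺ʳ X) r
  H-sound hStarE t refl = ε
  H-sound (hStarN {d = d} {ds} h) t r with Rels-++ (d ∷ ds) r
  ... | u , p , (_ , q , refl) = H-sound h t p ◅ q

  trace-sound : ∀ {γs w v} → Trace _⊨_ γs w v → Rels γs w v
  trace-sound nil = refl
  trace-sound (unf {ds = ds} h t r) with Rels-++ ds (trace-sound r)
  ... | u , p , q = u , H-sound h t p , q
  trace-sound (stp r t) = _ , r , trace-sound t

  Rels-boxes : ∀ γs {ψ w v} → Rels γs w v → w ⊨ boxes γs ψ → v ⊨ ψ
  Rels-boxes []       refl p = p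
  Rels-boxes (γ ∷ γs) (u , r , rs) p = Rels-boxes γs rs (p u r)

-- Worlds and accessibility.

module Construction (Cl : List Form) (closed : RuleClosed Cl) (Γ : List Form) where

  open Completeness Cl closed

  Root : List Form → Set
  Root S = Good S × Γ ⊆ S

  First : List (List Form) → List Form → Set
  First []       S = ⊥
  First (x ∷ xs) S = (Root x × x ≡ S) ⊎ (¬ Root x × First xs S)

  First-unique : ∀ xs {S S′} → First xs S → First xs S′ → S ≡ S′
  First-unique (x ∷ xs) (inj₁ (_ , refl)) (inj₁ (_ , refl)) = refl
  First-unique (x ∷ xs) (inj₁ (r , _)) (inj₂ (n , _)) = ⊥-elim (n r)
  First-unique (x ∷ xs) (inj₂ (n , _)) (inj₁ (r , _)) = ⊥-elim (n r)
  First-unique (x ∷ xs) (inj₂ (_ , f)) (inj₂ (_ , f′)) = First-unique xs f f′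

  First-root : ∀ xs {S} → First xs S → Root S
  First-root (x ∷ xs) (inj₁ (r , refl)) = r
  First-root (x ∷ xs) (inj₂ (_ , f)) = First-root xs f

  First-exists : ∀ xs {S} → S ∈ xs → Root S → ¬ ¬ (∃[ S ] First xs S)
  First-exists (x ∷ xs) (here refl) r κ = κ (x , inj₁ (r , refl))
  First-exists (x ∷ xs) (there i) r κ =
    First-exists xs i r λ { (S , f) → κ (S , inj₂ ((λ rx → κ (x , inj₁ (rx , refl))) , f)) }

  -- The worlds are the good sets together with one further world, which stands for the first
  -- good superset of Γ: as Good is not decidable, that set exists only up to double negation.
  World : Set
  World = ∃ Good ⊎ ⊤

  _≜_ : World → List Form → Set
  inj₁ (S , _) ≜ S′ = S ≡ S′
  inj₂ _       ≜ S′ = First (subs Cl) S′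

  is-unique : ∀ w {S S′} → w ≜ S → w ≜ S′ → S ≡ S′
  is-unique (inj₁ _) refl refl = refl
  is-unique (inj₂ _) = First-unique (subs Cl)

  is-good : ∀ w {S} → w ≜ S → Good S
  is-good (inj₁ (_ , g)) refl = g
  is-good (inj₂ _) f = proj₁ (First-root (subs Cl) f)

  _∋_ : World → Form → Set
  w ∋ φ = ¬ ¬ (∃[ S ] (w ≜ S × φ ∈ S))

  -- Membership in a list is decidable, so the double negation in `_∋_` disappears once the set of
  -- the world is given.
  ∋⇒∈ : ∀ w {S φ} → w ≜ S → w ∋ φ → φ ∈ S
  ∋⇒∈ w {S} {φ} is m = decidable-stable (φ ∈F? S) λ n →
    m λ { (S′ , is′ , i) → n (subst (φ ∈_) (is-unique w is′ is) i) }

  ∈⇒∋ : ∀ w {S φ} → w ≜ S → φ ∈ S → w ∋ φ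
  ∈⇒∋ _ is i κ = κ (_ , is , i)

  M : Model
  M = record { W = World ; R = λ a w v → ∀ ψ → w ∋ (⟦ atm a ⟧ ψ) → v ∋ ψ ; V = λ p w → w ∋ var p }

  open Sem M
  open Traces M

  prepend : ∀ {w S φ γs δs v} → w ≜ S → Loc S φ γs δs → Trace _∋_ δs w v → Trace _∋_ γs w v
  prepend is done          t = t
  prepend {w} is (unf h s _ l) t = unf h (∈⇒∋ w is ∘ s) (prepend is l t)

  run-trace : ∀ {φ S γs} w → w ≜ S → Run φ S γs → ∃[ v ] (Trace _∋_ γs w v × v ∋ (~ φ))
  run-trace w is (stop g l i) = w , prepend is l nil , ∈⇒∋ w is i
  run-trace w is (move {S′ = S′} g l link run) with run-trace (inj₁ (S′ , Run-good run)) refl run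
  ... | v , t , m = v , prepend is l (stp (λ ψ n → ∈⇒∋ (inj₁ (S′ , Run-good run)) refl (link (∋⇒∈ w is n))) t) , m

  -- The truth lemma.

  Truth : Form → Set
  Truth φ = (∀ w → w ∋ φ → w ⊨ φ) × (∀ w → w ∋ (~ φ) → ¬ (w ⊨ φ))

  -- Saturation of a box selects some `ℓ` and puts `~ τ` into the world for each test `τ` outside
  -- `ℓ`. The tests `X` used by the trace are true, so all of them lie in `ℓ`; hence the unfolding
  -- `ds` belongs to `P ℓ α` and its box formula is in the world.
  box-trace : ∀ {γs φ w v} → (∀ {γ τ} → γ ∈ γs → τ ∈ Tests γ → Truth τ) →
    Trace _⊨_ γs w v → w ∋ boxes γs φ → v ∋ φ
  box-trace tr nil m = m
  box-trace tr (stp r t) m = box-trace (tr ∘ there) t (r _ m)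
  box-trace {φ = φ} {w} tr (unf {α} {X} {ds} {γs} h x t) m = box-trace tr′ t unfolded-∋
    where
    tr′ : ∀ {γ τ} → γ ∈ ds ++ γs → τ ∈ Tests γ → Truth τ
    tr′ i j with ∈-++⁻ ds i
    ... | inj₁ k = tr (here refl) (H-res-tests h k j)
    ... | inj₂ k = tr (there k) j
    unfolded-∋ : w ∋ boxes (ds ++ γs) φ
    unfolded-∋ κ with atomic? α
    unfolded-∋ κ | inj₁ (a , refl) = subst (λ l → w ∋ boxes (l ++ γs) φ) (sym (H-atm h)) m κ
    unfolded-∋ κ | inj₂ na = m in-S
      where
      in-S : ¬ (∃[ S ] (w ≜ S × ⟦ α ⟧ boxes γs φ ∈ S))
      in-S (S , is , i) with Good.saturated (is-good w is) i (nonAtomic≢0 α na)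
      ... | e , j , s with ∈-map⁻ (boxExp α (boxes γs φ)) j
      ...   | ℓ , _ , refl = κ (S , is , subst (_∈ S) (sym (boxes-++ ds γs φ))
                (s (∈-++⁺ʳ _ (∈-map⁺ (λ ds → boxes ds (boxes γs φ)) (∈listP⁺ (H⇒P h X⊆ℓ))))))
        where
        F? = λ τ → ¬? (τ ∈F? ℓ)
        X⊆ℓ : X ⊆ ℓ
        X⊆ℓ {τ} k = decidable-stable (τ ∈F? ℓ) λ n →
          proj₂ (tr (here refl) (H-tests h k)) w
            (∈⇒∋ w is (s (∈-++⁺ˡ (∈-map⁺ ~_ (∈-filter⁺ F? (H-tests h k) n))))) (x k)

  trace-true : ∀ {γs w v} → (∀ {γ τ} → γ ∈ γs → τ ∈ Tests γ → Truth τ) → Trace _∋_ γs w v → Trace _⊨_ γs w v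
  trace-true tr nil = nil
  trace-true tr (stp r t) = stp r (trace-true (tr ∘ there) t)
  trace-true {w = w} tr (unf {α} {X} {ds} {γs} h x t) =
    unf h (λ i → proj₁ (tr (here refl) (H-tests h i)) w (x i)) (trace-true tr′ t)
    where
    tr′ : ∀ {γ τ} → γ ∈ ds ++ γs → τ ∈ Tests γ → Truth τ
    tr′ i j with ∈-++⁻ ds i
    ... | inj₁ k = tr (here refl) (H-res-tests h k j)
    ... | inj₂ k = tr (there k) j

  -- φ without its leading boxes: a run for ¬[γs]ψ is only known to end in a world containing ¬ψ.
  record Stripped (φ : Form) : Set where
    constructor stripped
    field
      γs     : List Prog
      ψ      : Form
      eq     : φ ≡ boxes γs ψ
      notBox : NotBox ψ
      tests  : ∀ {γ τ} → γ ∈ γs → τ ∈ Tests γ → Truth τ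
      refute : ∀ w → w ∋ (~ ψ) → ¬ (w ⊨ ψ)

  -- The leading boxes form one goal, so `exists-run` leads to a world containing `~ ψ`. On the
  -- trace of this run the tests are members of worlds; `tests` makes them true, so the trace is an
  -- execution of `γs`, and truth of `boxes γs ψ` would force `ψ` at its end.
  refute-stripped : ∀ {φ} → Stripped φ → ∀ w → w ∋ (~ φ) → ¬ (w ⊨ φ)
  refute-stripped (stripped γs ψ refl nb tests refute) w m p =
    m λ { (S , is , i) → exists-run (is-good w is) γs ψ nb i λ run →
      let (v , t , n) = run-trace w is run in
      refute v n (Rels-boxes γs (trace-sound (trace-true tests t)) p) }

  atom : ∀ {φ} → NotBox φ → Truth φ → Truth φ × Stripped φ
  atom nb t = t , stripped [] _ refl nb (λ ()) (proj₂ t)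

  clash : ∀ w {φ} → wt⁺ φ ≡ 0 → wt⁻ φ ≡ 0 → w ∋ φ → ¬ (w ∋ (~ φ))
  clash w z z′ m n = m λ { (S , is , i) → let open Good (is-good w is) in
    cons (tClosed (inj₂ (_ , core i z , core (∋⇒∈ w is n) z′))) }

  mutual
    truth : ∀ φ → Truth φ × Stripped φ
    truth bot = atom tt ((λ w m → m λ { (S , is , i) → let open Good (is-good w is) in
      cons (tClosed (inj₁ (core i refl))) }) , (λ _ _ ()))
    truth (var p) = atom tt ((λ _ m → m) , (λ w n m → clash w refl refl m n))
    truth (~ φ) = atom tt (proj₂ (proj₁ (truth φ)) , λ w m n → m λ { (S , is , i) → double w is n (Good.saturated (is-good w is) i (λ ())) })
      where
      double : ∀ w {S} → w ≜ S → w ⊨ (~ φ) → ¬ (∃[ e ] (e ∈ expF (~ ~ φ) × e ⊆ S))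
      double w is n (_ , here refl , s) = n (proj₁ (proj₁ (truth φ)) w (∈⇒∋ w is (s (here refl))))
    truth (φ ⋀ ψ) = atom tt
      ( (λ w m → proj₁ (proj₁ (truth φ)) w (λ κ → m λ { (S , is , i) → κ (S , is , proj₁ (both (Good.saturated (is-good w is) i (λ ())))) })
               , proj₁ (proj₁ (truth ψ)) w (λ κ → m λ { (S , is , i) → κ (S , is , proj₂ (both (Good.saturated (is-good w is) i (λ ())))) }))
      , (λ w m p → m λ { (S , is , i) → either w is p (Good.saturated (is-good w is) i (λ ())) }) )
      where
      both : ∀ {S} → ∃[ e ] (e ∈ expF (φ ⋀ ψ) × e ⊆ S) → φ ∈ S × ψ ∈ S
      both (_ , here refl , s) = s (here refl) , s (there (here refl))
      either : ∀ w {S} → w ≜ S → w ⊨ (φ ⋀ ψ) → ¬ (∃[ e ] (e ∈ expF (~ (φ ⋀ ψ)) × e ⊆ S))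
      either w is (p , _) (_ , here refl , s) = proj₂ (proj₁ (truth φ)) w (∈⇒∋ w is (s (here refl))) p
      either w is (_ , q) (_ , there (here refl) , s) = proj₂ (proj₁ (truth ψ)) w (∈⇒∋ w is (s (here refl))) q
    truth (⟦ α ⟧ φ) = (verify , refute-stripped strip) , strip
      where
      verify : ∀ w → w ∋ (⟦ α ⟧ φ) → w ⊨ (⟦ α ⟧ φ)
      verify w m v r = proj₁ (proj₁ (truth φ)) v
        (box-trace {γs = [ α ]} (λ { (here refl) i → truthTests α i }) (fold (unfold-Rel α r nil)) m)
      strip : Stripped (⟦ α ⟧ φ)
      strip with proj₂ (truth φ)
      ... | stripped γs ψ refl nb tests refute =
        stripped (α ∷ γs) ψ refl nb (λ { (here refl) i → truthTests α i ; (there j) i → tests j i }) refute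

    truthTests : ∀ α {τ} → τ ∈ Tests α → Truth τ
    truthTests (τ ¿) (here refl) = proj₁ (truth τ)
    truthTests (α ∪ₚ β) i with ∈-++⁻ (Tests α) i
    ... | inj₁ j = truthTests α j
    ... | inj₂ j = truthTests β j
    truthTests (α ⨟ β) i with ∈-++⁻ (Tests α) i
    ... | inj₁ j = truthTests α j
    ... | inj₂ j = truthTests β j
    truthTests (α ✶) i = truthTests α i

  root-exists : Γ ⊆ Cl → ¬ Tab [] false (map plain Γ) → ¬ ¬ (∃[ S ] First (subs Cl) S)
  root-exists sub nt κ =
    -- For the empty program list `Track` says that no formula is loaded, so `bot` is an arbitrary
    -- goal.
    saturate (suc (weight (map plain Γ))) [] (map plain Γ) bot [] ≤-refl nt inC
      ((λ ()) , (λ i isl → ⊥-elim (plain-free i isl))) λ r →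
    let open Saturation r
        -- `S` has its own order and repetitions; its copy cut out of `Cl` is a sublist and hence
        -- occurs in `subs Cl`.
        S° = filter (_∈F? S) Cl
        to : S ⊆ S°
        to i = ∈-filter⁺ (_∈F? S) (S⊆Cl i) i
        from : S° ⊆ S
        from i = proj₂ (∈-filter⁻ (_∈F? S) {xs = Cl} i)
        free = Track-free (subst (λ δs → Track bot δs B) (Loc-[] loc) track)
    in First-exists (subs Cl) (filter∈subs (_∈F? S) Cl)
         (Good-≈ to from (good-free r free) , (λ i → to (Y⊆S (∈-map⁺ plain i)))) κ
    where
    inC : InCl (map plain Γ)
    inC i with ∈-map⁻ plain i
    ... | _ , j , refl = sub j

  satisfiable : Γ ⊆ Cl → ¬ Tab [] false (map plain Γ) → Satisfiable Γ
  satisfiable sub nt = M , inj₂ tt , All.tabulate λ {φ} i →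
    -- The root set exists only up to double negation, which suffices because `_∋_` is doubly
    -- negated.
    proj₁ (proj₁ (truth φ)) (inj₂ tt) λ κ →
      root-exists sub nt λ { (S , f) → κ (S , f , proj₂ (First-root (subs Cl) f) i) }

theorem6p1 : (Γ : List Form) → Consistent Γ → Satisfiable Γ
theorem6p1 Γ con = Construction.satisfiable (closure Γ) (closure-closed Γ) Γ (closure-⊇ Γ) λ t →
  Tab⇒Closed [] (λ ()) t λ c → con (subst (λ h → ClosedTab h false (map plain Γ)) base-[] c)
  where
  base-[] : baseHist (map plain Γ) [] ≡ []
  base-[] with loaded? (map plain Γ)
  ... | yes _ = refl
  ... | no _  = refl
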